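{- For all positive integers $i, b$ with $b \le 5i + 4$, there exists a rational convex polygon $P \subset \mathbb{R}^2$ that is pseudointegral and satisfies $|\operatorname{int}(P) \cap \mathbb{Z}^2| = i$ and $|\partial P \cap \mathbb{Z}^2| = b$.
   Context: A polygon is rational if its vertices lie in $\mathbb{Q}^2$. A polytope $P\subset\mathbb{R}^d$ is pseudointegral (a PIP) if its Ehrhart function $t \mapsto |tP \cap \mathbb{Z}^d|$ ($t\in\mathbb{Z}_{>0}$) is a polynomial in $t$. $\operatorname{int}(P)$ and $\partial P$ denote the topological interior and boundary. -}

module Defs where

open import Data.Nat as ℕ using (ℕ; suc)
open import Data.Nat.DivMod using (_%_; m%n<n)
open import Data.Integer using (ℤ; +_)
open import Data.Rational using (ℚ; _+_; _*_; _-_; _<_; _≤_; 0ℚ; _/_)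
open import Data.Fin using (Fin; toℕ; fromℕ<)
open import Data.Product using (_×_; _,_; Σ; proj₁; proj₂)
open import Data.List using (List; []; _∷_; foldr; length)
open import Data.List.Membership.Propositional using (_∈_)
open import Data.List.Relation.Unary.Unique.Propositional using (Unique)
open import Relation.Binary.PropositionalEquality using (_≡_; _≢_)
open import Relation.Nullary using (¬_)
open import Function.Bundles using (_⇔_)

ℚ² : Set
ℚ² = ℚ × ℚ

ℤ² : Set
ℤ² = ℤ × ℤ

ℤ→ℚ : ℤ → ℚ
ℤ→ℚ z = z / 1

ℕ→ℚ : ℕ → ℚ
ℕ→ℚ n = (+ n) / 1

embed : ℤ² → ℚ²
embed (a , b) = ℤ→ℚ a , ℤ→ℚ b

next : ∀ {m} → Fin (suc m) → Fin (suc m)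
next {m} i = fromℕ< (m%n<n (suc (toℕ i)) (suc m))

-- cross product (q - p) × (r - p): positive iff r lies strictly left of the directed line p→q
cross : ℚ² → ℚ² → ℚ² → ℚ
cross (px , py) (qx , qy) (rx , ry) = ((qx - px) * (ry - py)) - ((qy - py) * (rx - px))

-- A rational convex polygon, given by its m+1 ≥ 3 vertices in counterclockwise order:
-- every vertex other than the endpoints of an edge lies strictly to the left of that edge.
record Polygon : Set where
  field
    m         : ℕ
    m≥2       : 2 ℕ.≤ m
    vertex    : Fin (suc m) → ℚ²
    strictlyConvexCCW : (k j : Fin (suc m)) → j ≢ k → j ≢ next k →
                        0ℚ < cross (vertex k) (vertex (next k)) (vertex j)
open Polygon public

scale : ℚ → ℚ² → ℚ²
scale t (x , y) = t * x , t * y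

-- x ∈ t·P  (closed polygon = intersection of the closed left half-planes of its edges)
InDilate : Polygon → ℚ → ℚ² → Set
InDilate P t x = (k : Fin (suc (m P))) →
  0ℚ ≤ cross (scale t (vertex P k)) (scale t (vertex P (next k))) x
InInterior : Polygon → ℚ² → Set
InInterior P x = (k : Fin (suc (m P))) →
  0ℚ < cross (vertex P k) (vertex P (next k)) x

InP : Polygon → ℚ² → Set
InP P = InDilate P (ℕ→ℚ 1)

OnBoundary : Polygon → ℚ² → Set
OnBoundary P x = InP P x × ¬ InInterior P x

HasCard : (ℤ² → Set) → ℕ → Set
HasCard S c = Σ (List ℤ²) λ l → Unique l × ((z : ℤ²) → (z ∈ l) ⇔ S z) × length l ≡ c

evalPoly : List ℚ → ℚ → ℚ
evalPoly cs t = foldr (λ c acc → c + t * acc) 0ℚ cs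

Pseudointegral : Polygon → Set
Pseudointegral P = Σ (List ℚ) λ cs → (t : ℕ) → 1 ℕ.≤ t →
  Σ ℕ λ c → HasCard (λ z → InDilate P (ℕ→ℚ t) (embed z)) c × ℕ→ℚ c ≡ evalPoly cs (ℕ→ℚ t)

{-# OPTIONS --safe #-}

-- Write g = i - 1. The triangle 0 ≤ y, y + 2 ≤ 4x, x + 6y ≤ 8 (the polygon of the weighted projective
-- plane P(1,4,25)) is pseudointegral with i = 1 and b = 9. For b ≥ 2 put δ = 5i + 4 - b and move the
-- right end of row y of its t-th dilate by g ((6t - 5y)⁺ - (t - 5y)⁺) - δ (t - y)⁺, that is, replace
-- the right edge by an edge path with bends at heights t/5 and t. The result is again a convex polygon,
-- with sides on lattice lines. The two terms with factor g have fractional bends, but the substitution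
-- y ↦ y + t turns one into the other, so their fractional parts cancel in the sum over the rows and the
-- count stays polynomial. Each unit of g adds one interior and five boundary points, each unit of δ
-- removes one boundary point.
-- For b = 1 the triangle 0 ≤ y, 3y + 4 ≤ 8x, 8x ≤ y + 8 has i = b = 1, and its rows are extended by
-- g min(y, 2t - y).
module Submission where

open import Defs
open import Data.Nat
open import Data.Nat.Properties
open import Data.Nat.DivMod
open import Data.Nat.Divisibility using (divides-refl)
open import Data.Nat.Tactic.RingSolver using (solve; solve-∀)
import Data.Nat as ℕ
open import Data.Integer as ℤ using (ℤ; +_; -[1+_])
import Data.Integer.Properties as ℤₚ
open import Data.Rational as ℚ using (ℚ; 0ℚ; 1ℚ; ½; Positive; positive; 1/_; toℚᵘ)
import Data.Rational.Properties as ℚₚ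
open import Data.Rational.Solver using (module +-*-Solver)
open import Data.Rational.Unnormalised as ℚᵘ using (mkℚᵘ)
import Data.Rational.Unnormalised.Properties as ℚᵘₚ
open import Data.Fin using (Fin; toℕ)
open import Data.Fin.Patterns
open import Data.Fin.Properties using (toℕ<n; all?) renaming (_≟_ to _≟ᶠ_)
open import Data.List using (List; []; _∷_; _++_; lookup; map; upTo; length)
open import Data.List.Properties using (length-++; length-map; length-upTo)
open import Data.List.Membership.Propositional using (_∈_)
open import Data.List.Membership.Propositional.Properties
  using (∈-map⁺; ∈-map⁻; ∈-++⁺ˡ; ∈-++⁺ʳ; ∈-++⁻; ∈-upTo⁺; ∈-upTo⁻)
open import Data.List.Relation.Binary.Disjoint.Propositional using (Disjoint)
import Data.List.Relation.Unary.AllPairs as AllPairs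
open import Data.List.Relation.Unary.Unique.Propositional using (Unique)
import Data.List.Relation.Unary.Unique.Propositional.Properties as Unique
open import Data.Product using (Σ; _×_; _,_; proj₁; proj₂; ∃-syntax)
open import Data.Sum using (_⊎_; inj₁; inj₂)
open import Data.Unit using (tt)
open import Function.Base using (_∘_)
open import Function.Bundles using (_⇔_; mk⇔; Equivalence)
open import Relation.Binary.PropositionalEquality
open import Relation.Nullary using (¬_; contradiction; ¬?)
open import Relation.Nullary.Decidable using (True; toWitness; _→-dec_)
open +-*-Solver using (_:+_; _:*_; _:-_; _:=_; con) renaming (solve to solveℚ)

-- Embedding of ℤ into ℚ

-- The Ehrhart polynomial is forced: constant term 1 and reciprocity leave only (i - 1 + b/2) t² +
-- (b/2) t + 1, as in Pick's formula. Lattice polygons cannot realise all pairs: they have b ≥ 3,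
-- and Scott's bound b ≤ 2i + 7 is below 5i + 4 for i ≥ 2. In the family for b ≥ 2 each right edge
-- has the form x ≤ (integer) y + (integer) t, so the right ends of rows are integers. Rounding
-- enters only through the left edge, which depends neither on g nor on δ, and through the number of
-- rows, 1 + ⌊6t/5⌋. With c = b - 1 as parameter in place of δ, the term of row n with factor g is
-- min(t, 5n) - 5 (n - t)⁺. Put k = ⌊t/5⌋: the rows n ≤ k contribute 5n, the other t rows contribute
-- t, and the rows t + j with j ≤ k lose 5j. Both sums of multiples of 5 run over 0, ..., k, so t²
-- remains. The bottom edge runs from 1/2 to b - 1, which leaves no room for b = 1; hence the second
-- family.

ℤ→ℚ-+ : ∀ a b → ℤ→ℚ (a ℤ.+ b) ≡ ℤ→ℚ a ℚ.+ ℤ→ℚ b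
ℤ→ℚ-+ a b = ℚₚ.toℚᵘ-injective (begin
  toℚᵘ (ℤ→ℚ (a ℤ.+ b))                 ≈⟨ ℚₚ.toℚᵘ-fromℚᵘ _ ⟩
  mkℚᵘ (a ℤ.+ b) 0                      ≈⟨ ℚᵘₚ.≃-reflexive (cong₂ (λ u v → mkℚᵘ (u ℤ.+ v) 0) (sym (ℤₚ.*-identityʳ a)) (sym (ℤₚ.*-identityʳ b))) ⟩
  mkℚᵘ a 0 ℚᵘ.+ mkℚᵘ b 0                ≈⟨ ℚᵘₚ.+-cong (ℚₚ.toℚᵘ-fromℚᵘ (mkℚᵘ a 0)) (ℚₚ.toℚᵘ-fromℚᵘ (mkℚᵘ b 0)) ⟨
  toℚᵘ (ℤ→ℚ a) ℚᵘ.+ toℚᵘ (ℤ→ℚ b)       ≈⟨ ℚₚ.toℚᵘ-homo-+ (ℤ→ℚ a) (ℤ→ℚ b) ⟨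
  toℚᵘ (ℤ→ℚ a ℚ.+ ℤ→ℚ b)               ∎)
  where open ℚᵘₚ.≃-Reasoning

ℤ→ℚ-* : ∀ a b → ℤ→ℚ (a ℤ.* b) ≡ ℤ→ℚ a ℚ.* ℤ→ℚ b
ℤ→ℚ-* a b = ℚₚ.toℚᵘ-injective (begin
  toℚᵘ (ℤ→ℚ (a ℤ.* b))                 ≈⟨ ℚₚ.toℚᵘ-fromℚᵘ _ ⟩
  mkℚᵘ a 0 ℚᵘ.* mkℚᵘ b 0                ≈⟨ ℚᵘₚ.*-cong (ℚₚ.toℚᵘ-fromℚᵘ (mkℚᵘ a 0)) (ℚₚ.toℚᵘ-fromℚᵘ (mkℚᵘ b 0)) ⟨
  toℚᵘ (ℤ→ℚ a) ℚᵘ.* toℚᵘ (ℤ→ℚ b)       ≈⟨ ℚₚ.toℚᵘ-homo-* (ℤ→ℚ a) (ℤ→ℚ b) ⟨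
  toℚᵘ (ℤ→ℚ a ℚ.* ℤ→ℚ b)               ∎)
  where open ℚᵘₚ.≃-Reasoning

ℤ→ℚ-mono-≤ : ∀ {a b} → a ℤ.≤ b → ℤ→ℚ a ℚ.≤ ℤ→ℚ b
ℤ→ℚ-mono-≤ {a} {b} a≤b = ℚₚ.toℚᵘ-cancel-≤ (begin
  toℚᵘ (ℤ→ℚ a) ≃⟨ ℚₚ.toℚᵘ-fromℚᵘ (mkℚᵘ a 0) ⟩
  mkℚᵘ a 0     ≤⟨ ℚᵘ.*≤* (ℤₚ.*-monoʳ-≤-nonNeg (+ 1) a≤b) ⟩
  mkℚᵘ b 0     ≃⟨ ℚₚ.toℚᵘ-fromℚᵘ (mkℚᵘ b 0) ⟨
  toℚᵘ (ℤ→ℚ b) ∎)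
  where open ℚᵘₚ.≤-Reasoning

ℤ→ℚ-mono-< : ∀ {a b} → a ℤ.< b → ℤ→ℚ a ℚ.< ℤ→ℚ b
ℤ→ℚ-mono-< {a} {b} a<b = ℚₚ.toℚᵘ-cancel-< (begin-strict
  toℚᵘ (ℤ→ℚ a) ≃⟨ ℚₚ.toℚᵘ-fromℚᵘ (mkℚᵘ a 0) ⟩
  mkℚᵘ a 0     <⟨ ℚᵘ.*<* (ℤₚ.*-monoʳ-<-pos (+ 1) a<b) ⟩
  mkℚᵘ b 0     ≃⟨ ℚₚ.toℚᵘ-fromℚᵘ (mkℚᵘ b 0) ⟨
  toℚᵘ (ℤ→ℚ b) ∎)
  where open ℚᵘₚ.≤-Reasoning

ℤ→ℚ-cancel-≤ : ∀ {a b} → ℤ→ℚ a ℚ.≤ ℤ→ℚ b → a ℤ.≤ b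
ℤ→ℚ-cancel-≤ p = ℤₚ.≮⇒≥ (λ b<a → ℚₚ.<-irrefl refl (ℚₚ.≤-<-trans p (ℤ→ℚ-mono-< b<a)))

ℤ→ℚ-cancel-< : ∀ {a b} → ℤ→ℚ a ℚ.< ℤ→ℚ b → a ℤ.< b
ℤ→ℚ-cancel-< p = ℤₚ.≰⇒> (λ b≤a → ℚₚ.<-irrefl refl (ℚₚ.<-≤-trans p (ℤ→ℚ-mono-≤ b≤a)))

q-p+p≡q : ∀ p q → q ℚ.- p ℚ.+ p ≡ q
q-p+p≡q = solveℚ 2 (λ p q → q :- p :+ p := q) refl

0≤m*[q-p]⇔p≤q : ∀ m p q .{{_ : Positive m}} → (0ℚ ℚ.≤ m ℚ.* (q ℚ.- p)) ⇔ (p ℚ.≤ q)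
0≤m*[q-p]⇔p≤q m p q = mk⇔
  (λ h → subst₂ ℚ._≤_ (ℚₚ.+-identityˡ p) (q-p+p≡q p q)
    (ℚₚ.+-monoˡ-≤ p (ℚₚ.*-cancelˡ-≤-pos m (subst (ℚ._≤ m ℚ.* (q ℚ.- p)) (sym (ℚₚ.*-zeroʳ m)) h))))
  (λ h → subst (ℚ._≤ m ℚ.* (q ℚ.- p)) (ℚₚ.*-zeroʳ m)
    (ℚₚ.*-monoˡ-≤-nonNeg m {{ℚₚ.pos⇒nonNeg m}} (subst (ℚ._≤ q ℚ.- p) (ℚₚ.+-inverseʳ p) (ℚₚ.+-monoˡ-≤ (ℚ.- p) {p} {q} h))))

0<m*[q-p]⇔p<q : ∀ m p q .{{_ : Positive m}} → (0ℚ ℚ.< m ℚ.* (q ℚ.- p)) ⇔ (p ℚ.< q)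
0<m*[q-p]⇔p<q m p q = mk⇔
  (λ h → subst₂ ℚ._<_ (ℚₚ.+-identityˡ p) (q-p+p≡q p q)
    (ℚₚ.+-monoˡ-< p (ℚₚ.*-cancelˡ-<-nonNeg m {{ℚₚ.pos⇒nonNeg m}} (subst (ℚ._< m ℚ.* (q ℚ.- p)) (sym (ℚₚ.*-zeroʳ m)) h))))
  (λ h → subst (ℚ._< m ℚ.* (q ℚ.- p)) (ℚₚ.*-zeroʳ m)
    (ℚₚ.*-monoʳ-<-pos m (subst (ℚ._< q ℚ.- p) (ℚₚ.+-inverseʳ p) (ℚₚ.+-monoˡ-< (ℚ.- p) {p} {q} h))))

-- Polygons from half-planes with natural coefficients

-- A half-plane is an inequality between two such forms, with negative terms moved to the other
-- side. On points of the first quadrant it then lives in ℕ, where a semiring identity settles every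
-- comparison. The third variable is the dilation factor.
record Form : Set where
  constructor _∙x+_∙y+_∙t
  field α β γ : ℕ

infix 8 _∙x+_∙y+_∙t

⟦_⟧ : Form → ℕ → ℕ → ℕ → ℕ
⟦ α ∙x+ β ∙y+ γ ∙t ⟧ x y t = α ℕ.* x ℕ.+ β ℕ.* y ℕ.+ γ ℕ.* t

⟦_⟧ℤ : Form → ℤ → ℤ → ℤ → ℤ
⟦ α ∙x+ β ∙y+ γ ∙t ⟧ℤ x y t = + α ℤ.* x ℤ.+ + β ℤ.* y ℤ.+ + γ ℤ.* t

⟦_⟧ℚ : Form → ℚ → ℚ → ℚ → ℚ
⟦ α ∙x+ β ∙y+ γ ∙t ⟧ℚ x y t = ℕ→ℚ α ℚ.* x ℚ.+ ℕ→ℚ β ℚ.* y ℚ.+ ℕ→ℚ γ ℚ.* t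

⟦⟧ℚ-ℤ→ℚ : ∀ f x y t → ⟦ f ⟧ℚ (ℤ→ℚ x) (ℤ→ℚ y) (ℤ→ℚ t) ≡ ℤ→ℚ (⟦ f ⟧ℤ x y t)
⟦⟧ℚ-ℤ→ℚ (α ∙x+ β ∙y+ γ ∙t) x y t = sym (begin
  ℤ→ℚ (+ α ℤ.* x ℤ.+ + β ℤ.* y ℤ.+ + γ ℤ.* t)
    ≡⟨ ℤ→ℚ-+ (+ α ℤ.* x ℤ.+ + β ℤ.* y) (+ γ ℤ.* t) ⟩
  ℤ→ℚ (+ α ℤ.* x ℤ.+ + β ℤ.* y) ℚ.+ ℤ→ℚ (+ γ ℤ.* t)
    ≡⟨ cong₂ ℚ._+_ (ℤ→ℚ-+ (+ α ℤ.* x) (+ β ℤ.* y)) (ℤ→ℚ-* (+ γ) t) ⟩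
  ℤ→ℚ (+ α ℤ.* x) ℚ.+ ℤ→ℚ (+ β ℤ.* y) ℚ.+ ℕ→ℚ γ ℚ.* ℤ→ℚ t
    ≡⟨ cong (ℚ._+ ℕ→ℚ γ ℚ.* ℤ→ℚ t) (cong₂ ℚ._+_ (ℤ→ℚ-* (+ α) x) (ℤ→ℚ-* (+ β) y)) ⟩
  ⟦ α ∙x+ β ∙y+ γ ∙t ⟧ℚ (ℤ→ℚ x) (ℤ→ℚ y) (ℤ→ℚ t) ∎)
  where open ≡-Reasoning

⟦⟧ℤ-+ : ∀ f x y t → ⟦ f ⟧ℤ (+ x) (+ y) (+ t) ≡ + (⟦ f ⟧ x y t)
⟦⟧ℤ-+ (α ∙x+ β ∙y+ γ ∙t) x y t = cong₂ ℤ._+_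
  (cong₂ ℤ._+_ (sym (ℤₚ.pos-* α x)) (sym (ℤₚ.pos-* β y))) (sym (ℤₚ.pos-* γ t))

⟦⟧ℚ-ℕ→ℚ : ∀ f x y t → ⟦ f ⟧ℚ (ℕ→ℚ x) (ℕ→ℚ y) (ℕ→ℚ t) ≡ ℕ→ℚ (⟦ f ⟧ x y t)
⟦⟧ℚ-ℕ→ℚ f x y t = trans (⟦⟧ℚ-ℤ→ℚ f (+ x) (+ y) (+ t)) (cong ℤ→ℚ (⟦⟧ℤ-+ f x y t))

ℕ→ℚ-+ : ∀ m n → ℕ→ℚ (m ℕ.+ n) ≡ ℕ→ℚ m ℚ.+ ℕ→ℚ n
ℕ→ℚ-+ m n = ℤ→ℚ-+ (+ m) (+ n)

ℕ→ℚ-* : ∀ m n → ℕ→ℚ (m ℕ.* n) ≡ ℕ→ℚ m ℚ.* ℕ→ℚ n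
ℕ→ℚ-* m n = trans (cong ℤ→ℚ (ℤₚ.pos-* m n)) (ℤ→ℚ-* (+ m) (+ n))

ℕ→ℚ-positive : ∀ n .{{_ : NonZero n}} → Positive (ℕ→ℚ n)
ℕ→ℚ-positive (suc n) = positive (ℤ→ℚ-mono-< {+ 0} {+ suc n} (ℤ.+<+ (s≤s z≤n)))

record HalfPlane : Set where
  constructor _≼_
  field lhs rhs : Form
open HalfPlane

infix 4 _≼_

-- The edge vector is `t * l * w` times the gradient of rhs - lhs turned clockwise. The cross
-- product with it therefore measures rhs - lhs at the point minus its value at the dilated vertex,
-- and the latter is zero because the vertex lies on the line.
cross-halfPlane : ∀ h t w d l X Y X′ Y′ x y → let open Form in
  X′ ℚ.+ l ℚ.* ℕ→ℚ (β (lhs h)) ≡ X ℚ.+ l ℚ.* ℕ→ℚ (β (rhs h)) →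
  Y′ ℚ.+ l ℚ.* ℕ→ℚ (α (rhs h)) ≡ Y ℚ.+ l ℚ.* ℕ→ℚ (α (lhs h)) →
  ⟦ lhs h ⟧ℚ X Y d ≡ ⟦ rhs h ⟧ℚ X Y d → w ℚ.* d ≡ 1ℚ →
  cross (scale t (X ℚ.* w , Y ℚ.* w)) (scale t (X′ ℚ.* w , Y′ ℚ.* w)) (x , y)
    ≡ t ℚ.* l ℚ.* w ℚ.* (⟦ rhs h ⟧ℚ x y t ℚ.- ⟦ lhs h ⟧ℚ x y t)
cross-halfPlane (α₁ ∙x+ β₁ ∙y+ γ₁ ∙t ≼ α₂ ∙x+ β₂ ∙y+ γ₂ ∙t) t w d l X Y X′ Y′ x y eX eY on wd≡1 = begin
  cross (scale t (X ℚ.* w , Y ℚ.* w)) (scale t (X′ ℚ.* w , Y′ ℚ.* w)) (x , y)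
    ≡⟨ cong₂ (λ u v → cross (scale t (X ℚ.* w , Y ℚ.* w)) (scale t (u ℚ.* w , v ℚ.* w)) (x , y))
         (move X′ _ _ eX) (move Y′ _ _ eY) ⟩
  cross (scale t (X ℚ.* w , Y ℚ.* w))
        (scale t ((X ℚ.+ l ℚ.* b₂ ℚ.- l ℚ.* b₁) ℚ.* w , (Y ℚ.+ l ℚ.* a₁ ℚ.- l ℚ.* a₂) ℚ.* w)) (x , y)
    -- A pure ring identity cannot use `w * d ≡ 1` or that the vertex lies on the line. So
    -- `t * (w * d)` and the two values at the vertex stay visible, and `identity` marks where they
    -- get replaced.
    ≡⟨ expand a₁ b₁ (ℕ→ℚ γ₁) a₂ b₂ (ℕ→ℚ γ₂) ⟩
  identity (t ℚ.* (w ℚ.* d)) (⟦ α₁ ∙x+ β₁ ∙y+ γ₁ ∙t ⟧ℚ X Y d)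
    ≡⟨ cong₂ identity (trans (cong (t ℚ.*_) wd≡1) (ℚₚ.*-identityʳ t)) on ⟩
  identity t (⟦ α₂ ∙x+ β₂ ∙y+ γ₂ ∙t ⟧ℚ X Y d)
    ≡⟨ cancel _ (t ℚ.* t ℚ.* l ℚ.* w ℚ.* w) (⟦ α₂ ∙x+ β₂ ∙y+ γ₂ ∙t ⟧ℚ X Y d) ⟩
  t ℚ.* l ℚ.* w ℚ.* (⟦ α₂ ∙x+ β₂ ∙y+ γ₂ ∙t ⟧ℚ x y t ℚ.- ⟦ α₁ ∙x+ β₁ ∙y+ γ₁ ∙t ⟧ℚ x y t) ∎
  where
  open ≡-Reasoning
  a₁ = ℕ→ℚ α₁
  a₂ = ℕ→ℚ α₂
  b₁ = ℕ→ℚ β₁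
  b₂ = ℕ→ℚ β₂
  identity : ℚ → ℚ → ℚ
  identity u v = t ℚ.* l ℚ.* w ℚ.* ((a₂ ℚ.* x ℚ.+ b₂ ℚ.* y ℚ.+ ℕ→ℚ γ₂ ℚ.* u)
                                    ℚ.- (a₁ ℚ.* x ℚ.+ b₁ ℚ.* y ℚ.+ ℕ→ℚ γ₁ ℚ.* u))
      ℚ.+ t ℚ.* t ℚ.* l ℚ.* w ℚ.* w ℚ.* (v ℚ.- ⟦ α₂ ∙x+ β₂ ∙y+ γ₂ ∙t ⟧ℚ X Y d)
  move : ∀ p q r → p ℚ.+ q ≡ r → p ≡ r ℚ.- q
  move p q r refl = solveℚ 2 (λ p q → p := p :+ q :- q) refl p q
  cancel : ∀ p q r → p ℚ.+ q ℚ.* (r ℚ.- r) ≡ p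
  cancel = solveℚ 3 (λ p q r → p :+ q :* (r :- r) := p) refl
  expand : ∀ a₁ b₁ c₁ a₂ b₂ c₂ →
    (t ℚ.* ((X ℚ.+ l ℚ.* b₂ ℚ.- l ℚ.* b₁) ℚ.* w) ℚ.- t ℚ.* (X ℚ.* w)) ℚ.* (y ℚ.- t ℚ.* (Y ℚ.* w))
      ℚ.- (t ℚ.* ((Y ℚ.+ l ℚ.* a₁ ℚ.- l ℚ.* a₂) ℚ.* w) ℚ.- t ℚ.* (Y ℚ.* w)) ℚ.* (x ℚ.- t ℚ.* (X ℚ.* w))
    ≡ t ℚ.* l ℚ.* w ℚ.* ((a₂ ℚ.* x ℚ.+ b₂ ℚ.* y ℚ.+ c₂ ℚ.* (t ℚ.* (w ℚ.* d)))
                         ℚ.- (a₁ ℚ.* x ℚ.+ b₁ ℚ.* y ℚ.+ c₁ ℚ.* (t ℚ.* (w ℚ.* d))))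
      ℚ.+ t ℚ.* t ℚ.* l ℚ.* w ℚ.* w ℚ.* ((a₁ ℚ.* X ℚ.+ b₁ ℚ.* Y ℚ.+ c₁ ℚ.* d)
                         ℚ.- (a₂ ℚ.* X ℚ.+ b₂ ℚ.* Y ℚ.+ c₂ ℚ.* d))
  expand a₁ b₁ c₁ a₂ b₂ c₂ = solveℚ 14 (λ a₁ b₁ c₁ a₂ b₂ c₂ t w d l X Y x y →
    (t :* ((X :+ l :* b₂ :- l :* b₁) :* w) :- t :* (X :* w)) :* (y :- t :* (Y :* w))
      :- (t :* ((Y :+ l :* a₁ :- l :* a₂) :* w) :- t :* (Y :* w)) :* (x :- t :* (X :* w))
    := t :* l :* w :* ((a₂ :* x :+ b₂ :* y :+ c₂ :* (t :* (w :* d)))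
                       :- (a₁ :* x :+ b₁ :* y :+ c₁ :* (t :* (w :* d))))
      :+ t :* t :* l :* w :* w :* ((a₁ :* X :+ b₁ :* Y :+ c₁ :* d) :- (a₂ :* X :+ b₂ :* Y :+ c₂ :* d)))
    refl a₁ b₁ c₁ a₂ b₂ c₂ t w d l X Y x y

-- The vertices are (X / d , Y / d); side i carries the edge from vertex i to vertex (next i),
-- whose direction is step i / d times the inner normal of the side, turned clockwise.
record Outline : Set where
  field
    k         : ℕ
    2≤k       : 2 ℕ.≤ k
    d         : ℕ
    {{d≢0}}   : NonZero d
    X Y step  : Fin (suc k) → ℕ
    side      : Fin (suc k) → HalfPlane
    step≢0    : ∀ i → NonZero (step i)
    forward-x : ∀ i → X (next i) ℕ.+ step i ℕ.* Form.β (lhs (side i)) ≡ X i ℕ.+ step i ℕ.* Form.β (rhs (side i))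
    forward-y : ∀ i → Y (next i) ℕ.+ step i ℕ.* Form.α (rhs (side i)) ≡ Y i ℕ.+ step i ℕ.* Form.α (lhs (side i))
    on-side   : ∀ i → ⟦ lhs (side i) ⟧ (X i) (Y i) d ≡ ⟦ rhs (side i) ⟧ (X i) (Y i) d
    inside    : ∀ i j → j ≢ i → j ≢ next i → ⟦ lhs (side i) ⟧ (X j) (Y j) d ℕ.< ⟦ rhs (side i) ⟧ (X j) (Y j) d

module Realise (O : Outline) where
  open Outline O

  private
    instance
      d-positive : Positive (ℕ→ℚ d)
      d-positive = ℕ→ℚ-positive d
      d-nonZero : ℚ.NonZero (ℕ→ℚ d)
      d-nonZero = ℚₚ.pos⇒nonZero (ℕ→ℚ d)

    w : ℚ
    w = 1/ ℕ→ℚ d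

    V : Fin (suc k) → ℚ²
    V i = ℕ→ℚ (X i) ℚ.* w , ℕ→ℚ (Y i) ℚ.* w

    instance
      w-positive : Positive w
      w-positive = ℚₚ.1/pos⇒pos (ℕ→ℚ d)

    μ : Fin (suc k) → ℚ → ℚ
    μ i t = t ℚ.* ℕ→ℚ (step i) ℚ.* w

    μ-positive : ∀ i t .{{_ : Positive t}} → Positive (μ i t)
    μ-positive i t = ℚₚ.pos*pos⇒pos (t ℚ.* ℕ→ℚ (step i))
      {{ℚₚ.pos*pos⇒pos t (ℕ→ℚ (step i)) {{ℕ→ℚ-positive (step i) {{step≢0 i}}}}}} w

    cast : ∀ m a b n c e → m ℕ.+ a ℕ.* b ≡ n ℕ.+ c ℕ.* e →
      ℕ→ℚ m ℚ.+ ℕ→ℚ a ℚ.* ℕ→ℚ b ≡ ℕ→ℚ n ℚ.+ ℕ→ℚ c ℚ.* ℕ→ℚ e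
    cast m a b n c e eq = begin
      ℕ→ℚ m ℚ.+ ℕ→ℚ a ℚ.* ℕ→ℚ b ≡⟨ cong (ℕ→ℚ m ℚ.+_) (ℕ→ℚ-* a b) ⟨
      ℕ→ℚ m ℚ.+ ℕ→ℚ (a ℕ.* b)   ≡⟨ ℕ→ℚ-+ m (a ℕ.* b) ⟨
      ℕ→ℚ (m ℕ.+ a ℕ.* b)        ≡⟨ cong ℕ→ℚ eq ⟩
      ℕ→ℚ (n ℕ.+ c ℕ.* e)        ≡⟨ ℕ→ℚ-+ n (c ℕ.* e) ⟩
      ℕ→ℚ n ℚ.+ ℕ→ℚ (c ℕ.* e)   ≡⟨ cong (ℕ→ℚ n ℚ.+_) (ℕ→ℚ-* c e) ⟩
      ℕ→ℚ n ℚ.+ ℕ→ℚ c ℚ.* ℕ→ℚ e ∎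
      where open ≡-Reasoning

    cross-side : ∀ i t x y → cross (scale t (V i)) (scale t (V (next i))) (x , y)
      ≡ μ i t ℚ.* (⟦ rhs (side i) ⟧ℚ x y t ℚ.- ⟦ lhs (side i) ⟧ℚ x y t)
    cross-side i t x y = cross-halfPlane (side i) t w (ℕ→ℚ d) (ℕ→ℚ (step i))
      (ℕ→ℚ (X i)) (ℕ→ℚ (Y i)) (ℕ→ℚ (X (next i))) (ℕ→ℚ (Y (next i))) x y
      (cast (X (next i)) (step i) _ (X i) (step i) _ (forward-x i))
      (cast (Y (next i)) (step i) _ (Y i) (step i) _ (forward-y i))
      (trans (⟦⟧ℚ-ℕ→ℚ (lhs (side i)) (X i) (Y i) d)
        (trans (cong ℕ→ℚ (on-side i)) (sym (⟦⟧ℚ-ℕ→ℚ (rhs (side i)) (X i) (Y i) d))))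
      (ℚₚ.*-inverseˡ (ℕ→ℚ d))

    unscaled : ∀ i → scale 1ℚ (V i) ≡ V i
    unscaled i = cong₂ _,_ (ℚₚ.*-identityˡ _) (ℚₚ.*-identityˡ _)

    cross-side₁ : ∀ i x y → cross (V i) (V (next i)) (x , y)
      ≡ μ i 1ℚ ℚ.* (⟦ rhs (side i) ⟧ℚ x y 1ℚ ℚ.- ⟦ lhs (side i) ⟧ℚ x y 1ℚ)
    cross-side₁ i x y = trans (cong₂ (λ p q → cross p q (x , y)) (sym (unscaled i)) (sym (unscaled (next i))))
      (cross-side i 1ℚ x y)

    -- Clearing the denominator of a vertex turns the dilation factor 1 into `d`, which reduces
    -- strict convexity to the inequalities `inside` between natural numbers.
    homogeneous : ∀ f x y → ⟦ f ⟧ℚ (ℕ→ℚ x ℚ.* w) (ℕ→ℚ y ℚ.* w) 1ℚ ≡ ℕ→ℚ (⟦ f ⟧ x y d) ℚ.* w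
    homogeneous f x y = begin
      a ℚ.* (x′ ℚ.* w) ℚ.+ b ℚ.* (y′ ℚ.* w) ℚ.+ c ℚ.* 1ℚ
        ≡⟨ cong (λ e → a ℚ.* (x′ ℚ.* w) ℚ.+ b ℚ.* (y′ ℚ.* w) ℚ.+ c ℚ.* e) (ℚₚ.*-inverseʳ d′) ⟨
      a ℚ.* (x′ ℚ.* w) ℚ.+ b ℚ.* (y′ ℚ.* w) ℚ.+ c ℚ.* (d′ ℚ.* w)
        ≡⟨ factor a b c x′ y′ d′ w ⟩
      ⟦ f ⟧ℚ x′ y′ d′ ℚ.* w
        ≡⟨ cong (ℚ._* w) (⟦⟧ℚ-ℕ→ℚ f x y d) ⟩
      ℕ→ℚ (⟦ f ⟧ x y d) ℚ.* w ∎
      where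
      open ≡-Reasoning
      a = ℕ→ℚ (Form.α f)
      b = ℕ→ℚ (Form.β f)
      c = ℕ→ℚ (Form.γ f)
      x′ = ℕ→ℚ x
      y′ = ℕ→ℚ y
      d′ = ℕ→ℚ d
      factor : ∀ a b c x y d w →
        a ℚ.* (x ℚ.* w) ℚ.+ b ℚ.* (y ℚ.* w) ℚ.+ c ℚ.* (d ℚ.* w) ≡ (a ℚ.* x ℚ.+ b ℚ.* y ℚ.+ c ℚ.* d) ℚ.* w
      factor = solveℚ 7 (λ a b c x y d w →
        a :* (x :* w) :+ b :* (y :* w) :+ c :* (d :* w) := (a :* x :+ b :* y :+ c :* d) :* w) refl

  polygon : Polygon
  polygon .m = k
  polygon .m≥2 = 2≤k
  polygon .vertex = V
  polygon .strictlyConvexCCW i j j≢i j≢next = subst (0ℚ ℚ.<_) (sym (cross-side₁ i _ _))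
    (Equivalence.from (0<m*[q-p]⇔p<q (μ i 1ℚ) _ _ {{μ-positive i 1ℚ}})
      (subst₂ ℚ._<_ (sym (homogeneous (lhs (side i)) (X j) (Y j))) (sym (homogeneous (rhs (side i)) (X j) (Y j)))
        (ℚₚ.*-monoˡ-<-pos w (ℤ→ℚ-mono-< (ℤ.+<+ (inside i j j≢i j≢next))))))

  InSides : ℕ → ℤ² → Set
  InSides t (x , y) = ∀ i → ⟦ lhs (side i) ⟧ℤ x y (+ t) ℤ.≤ ⟦ rhs (side i) ⟧ℤ x y (+ t)

  StrictlyInSides : ℤ² → Set
  StrictlyInSides (x , y) = ∀ i → ⟦ lhs (side i) ⟧ℤ x y (+ 1) ℤ.< ⟦ rhs (side i) ⟧ℤ x y (+ 1)

  InDilate⇔InSides : ∀ t .{{_ : NonZero t}} z → InDilate polygon (ℕ→ℚ t) (embed z) ⇔ InSides t z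
  InDilate⇔InSides t (x , y) = mk⇔
    (λ h i → ℤ→ℚ-cancel-≤ (subst₂ ℚ._≤_ (⟦⟧ℚ-ℤ→ℚ (lhs (side i)) x y (+ t)) (⟦⟧ℚ-ℤ→ℚ (rhs (side i)) x y (+ t))
      (Equivalence.to (equiv i) (subst (0ℚ ℚ.≤_) (cross-side i (ℕ→ℚ t) _ _) (h i)))))
    (λ h i → subst (0ℚ ℚ.≤_) (sym (cross-side i (ℕ→ℚ t) _ _)) (Equivalence.from (equiv i)
      (subst₂ ℚ._≤_ (sym (⟦⟧ℚ-ℤ→ℚ (lhs (side i)) x y (+ t))) (sym (⟦⟧ℚ-ℤ→ℚ (rhs (side i)) x y (+ t)))
        (ℤ→ℚ-mono-≤ (h i)))))
    where
    equiv = λ i → 0≤m*[q-p]⇔p≤q (μ i (ℕ→ℚ t)) _ _ {{μ-positive i (ℕ→ℚ t) {{ℕ→ℚ-positive t}}}}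

  InInterior⇔StrictlyInSides : ∀ z → InInterior polygon (embed z) ⇔ StrictlyInSides z
  InInterior⇔StrictlyInSides (x , y) = mk⇔
    (λ h i → ℤ→ℚ-cancel-< (subst₂ ℚ._<_ (⟦⟧ℚ-ℤ→ℚ (lhs (side i)) x y (+ 1)) (⟦⟧ℚ-ℤ→ℚ (rhs (side i)) x y (+ 1))
      (Equivalence.to (equiv i) (subst (0ℚ ℚ.<_) (cross-side₁ i _ _) (h i)))))
    (λ h i → subst (0ℚ ℚ.<_) (sym (cross-side₁ i _ _)) (Equivalence.from (equiv i)
      (subst₂ ℚ._<_ (sym (⟦⟧ℚ-ℤ→ℚ (lhs (side i)) x y (+ 1))) (sym (⟦⟧ℚ-ℤ→ℚ (rhs (side i)) x y (+ 1)))
        (ℤ→ℚ-mono-< (h i)))))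
    where
    equiv = λ i → 0<m*[q-p]⇔p<q (μ i 1ℚ) _ _ {{μ-positive i 1ℚ}}

-- From systems of half-planes to pseudointegral polygons

HasCard-⇔ : ∀ {S T n} → (∀ z → T z ⇔ S z) → HasCard S n → HasCard T n
HasCard-⇔ T⇔S (l , unique , ∈⇔S , len) = l , unique ,
  (λ z → mk⇔ (Equivalence.from (T⇔S z) ∘ Equivalence.to (∈⇔S z)) (Equivalence.from (∈⇔S z) ∘ Equivalence.to (T⇔S z))) , len

0≤∙y⇒nonNegative : ∀ x y t → ⟦ 0 ∙x+ 0 ∙y+ 0 ∙t ⟧ℤ x y t ℤ.≤ ⟦ 0 ∙x+ 1 ∙y+ 0 ∙t ⟧ℤ x y t → ∃[ n ] y ≡ + n
0≤∙y⇒nonNegative x (+ n)     t h = n , refl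
0≤∙y⇒nonNegative x -[1+ n ] t ()

-- Together with y ≥ 0 the left edge keeps all dilates in the first quadrant, so that afterwards
-- only natural coordinates occur.
≤∙x⇒nonNegative : ∀ α β γ x n t →
  ⟦ 0 ∙x+ β ∙y+ γ ∙t ⟧ℤ x (+ n) (+ t) ℤ.≤ ⟦ suc α ∙x+ 0 ∙y+ 0 ∙t ⟧ℤ x (+ n) (+ t) → ∃[ m ] x ≡ + m
≤∙x⇒nonNegative α β γ (+ m)     n t h = m , refl
≤∙x⇒nonNegative α β γ -[1+ m ] n t h
  -- The left form has coefficient 0 at x, so it reduces to its value at x = 0, a natural number,
  -- whereas the right form is negative.
  with () ← subst (ℤ._≤ ⟦ suc α ∙x+ 0 ∙y+ 0 ∙t ⟧ℤ -[1+ m ] (+ n) (+ t)) (⟦⟧ℤ-+ (0 ∙x+ β ∙y+ γ ∙t) 0 n t) h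

-- The coefficients are those of Pick's formula with g = i - 1. The hypothesis is doubled because t
-- (t + 1) b / 2 is not an expression in ℕ.
ehrhart : ∀ g b c t → 2 ℕ.* c ≡ 2 ℕ.* (g ℕ.* (t ℕ.* t)) ℕ.+ b ℕ.* (t ℕ.* suc t) ℕ.+ 2 →
  ℕ→ℚ c ≡ evalPoly (1ℚ ∷ ℕ→ℚ b ℚ.* ½ ∷ ℕ→ℚ g ℚ.+ ℕ→ℚ b ℚ.* ½ ∷ []) (ℕ→ℚ t)
ehrhart g b c t eq = begin
  ℕ→ℚ c
    ≡⟨ ℚₚ.*-identityˡ (ℕ→ℚ c) ⟨
  ½ ℚ.* ℕ→ℚ 2 ℚ.* ℕ→ℚ c
    ≡⟨ ℚₚ.*-assoc ½ (ℕ→ℚ 2) (ℕ→ℚ c) ⟩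
  ½ ℚ.* (ℕ→ℚ 2 ℚ.* ℕ→ℚ c)
    ≡⟨ cong (½ ℚ.*_) (ℕ→ℚ-* 2 c) ⟨
  ½ ℚ.* ℕ→ℚ (2 ℕ.* c)
    ≡⟨ cong (λ e → ½ ℚ.* ℕ→ℚ e) eq ⟩
  ½ ℚ.* ℕ→ℚ (2 ℕ.* (g ℕ.* (t ℕ.* t)) ℕ.+ b ℕ.* (t ℕ.* suc t) ℕ.+ 2)
    ≡⟨ cong (½ ℚ.*_) expand ⟩
  ½ ℚ.* (ℕ→ℚ 2 ℚ.* (G ℚ.* (T ℚ.* T)) ℚ.+ B ℚ.* (T ℚ.* (1ℚ ℚ.+ T)) ℚ.+ ℕ→ℚ 2)
    ≡⟨ regroup ½ (ℕ→ℚ 2) G B T ⟩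
  ½ ℚ.* ℕ→ℚ 2 ℚ.+ T ℚ.* (B ℚ.* ½ ℚ.+ T ℚ.* (½ ℚ.* ℕ→ℚ 2 ℚ.* G ℚ.+ B ℚ.* ½ ℚ.+ T ℚ.* 0ℚ))
    ≡⟨ cong (λ e → 1ℚ ℚ.+ T ℚ.* (B ℚ.* ½ ℚ.+ T ℚ.* (e ℚ.+ B ℚ.* ½ ℚ.+ T ℚ.* 0ℚ))) (ℚₚ.*-identityˡ G) ⟩
  1ℚ ℚ.+ T ℚ.* (B ℚ.* ½ ℚ.+ T ℚ.* (G ℚ.+ B ℚ.* ½ ℚ.+ T ℚ.* 0ℚ)) ∎
  where
  open ≡-Reasoning
  G = ℕ→ℚ g
  B = ℕ→ℚ b
  T = ℕ→ℚ t
  expand : ℕ→ℚ (2 ℕ.* (g ℕ.* (t ℕ.* t)) ℕ.+ b ℕ.* (t ℕ.* suc t) ℕ.+ 2)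
    ≡ ℕ→ℚ 2 ℚ.* (G ℚ.* (T ℚ.* T)) ℚ.+ B ℚ.* (T ℚ.* (1ℚ ℚ.+ T)) ℚ.+ ℕ→ℚ 2
  expand = trans (ℕ→ℚ-+ (2 ℕ.* (g ℕ.* (t ℕ.* t)) ℕ.+ b ℕ.* (t ℕ.* suc t)) 2) (cong (ℚ._+ ℕ→ℚ 2) (trans (ℕ→ℚ-+ (2 ℕ.* (g ℕ.* (t ℕ.* t))) (b ℕ.* (t ℕ.* suc t))) (cong₂ ℚ._+_
    (trans (ℕ→ℚ-* 2 (g ℕ.* (t ℕ.* t))) (cong (ℕ→ℚ 2 ℚ.*_) (trans (ℕ→ℚ-* g (t ℕ.* t)) (cong (G ℚ.*_) (ℕ→ℚ-* t t)))))
    (trans (ℕ→ℚ-* b (t ℕ.* suc t)) (cong (B ℚ.*_) (trans (ℕ→ℚ-* t (suc t)) (cong (T ℚ.*_) (ℕ→ℚ-+ 1 t))))))))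
  regroup : ∀ h w g b t → h ℚ.* (w ℚ.* (g ℚ.* (t ℚ.* t)) ℚ.+ b ℚ.* (t ℚ.* (1ℚ ℚ.+ t)) ℚ.+ w)
    ≡ h ℚ.* w ℚ.+ t ℚ.* (b ℚ.* h ℚ.+ t ℚ.* (h ℚ.* w ℚ.* g ℚ.+ b ℚ.* h ℚ.+ t ℚ.* 0ℚ))
  regroup = solveℚ 5 (λ h w g b t → h :* (w :* (g :* (t :* t)) :+ b :* (t :* (con 1ℚ :+ t)) :+ w)
    := h :* w :+ t :* (b :* h :+ t :* (h :* w :* g :+ b :* h :+ t :* con 0ℚ))) refl

Holds StrictlyHolds : ℕ → ℤ² → HalfPlane → Set
Holds         t (x , y) h = ⟦ lhs h ⟧ℤ x y (+ t) ℤ.≤ ⟦ rhs h ⟧ℤ x y (+ t)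
StrictlyHolds t (x , y) h = ⟦ lhs h ⟧ℤ x y (+ t) ℤ.< ⟦ rhs h ⟧ℤ x y (+ t)

-- The list of sides may be redundant: it is kept fixed while the vertices of degenerate members of a
-- family of polygons are dropped.
record Realisation {s} (sides : Fin s → HalfPlane) : Set₁ where
  field
    outline : Outline
    sides⇔  : ∀ (Q : HalfPlane → Set) → (∀ i → Q (Outline.side outline i)) ⇔ (∀ j → Q (sides j))

module _ {s} (sides : Fin s → HalfPlane) where

  Satisfies StrictlySatisfies : ℕ → ℤ² → Set
  Satisfies         t z = ∀ j → Holds t z (sides j)
  StrictlySatisfies t z = ∀ j → StrictlyHolds t z (sides j)

  Satisfies⇒ℕ : ∀ {t m n} → Satisfies t (+ m , + n) → ∀ j → ⟦ lhs (sides j) ⟧ m n t ℕ.≤ ⟦ rhs (sides j) ⟧ m n t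
  Satisfies⇒ℕ {t} {m} {n} h j = ℤₚ.drop‿+≤+ (subst₂ ℤ._≤_ (⟦⟧ℤ-+ (lhs (sides j)) m n t) (⟦⟧ℤ-+ (rhs (sides j)) m n t) (h j))

  ℕ⇒Satisfies : ∀ {t m n} → (∀ j → ⟦ lhs (sides j) ⟧ m n t ℕ.≤ ⟦ rhs (sides j) ⟧ m n t) → Satisfies t (+ m , + n)
  ℕ⇒Satisfies {t} {m} {n} h j = subst₂ ℤ._≤_ (sym (⟦⟧ℤ-+ (lhs (sides j)) m n t)) (sym (⟦⟧ℤ-+ (rhs (sides j)) m n t)) (ℤ.+≤+ (h j))

  StrictlySatisfies⇒ℕ : ∀ {t m n} → StrictlySatisfies t (+ m , + n) → ∀ j → ⟦ lhs (sides j) ⟧ m n t ℕ.< ⟦ rhs (sides j) ⟧ m n t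
  StrictlySatisfies⇒ℕ {t} {m} {n} h j = ℤₚ.drop‿+<+ (subst₂ ℤ._<_ (⟦⟧ℤ-+ (lhs (sides j)) m n t) (⟦⟧ℤ-+ (rhs (sides j)) m n t) (h j))

  ℕ⇒StrictlySatisfies : ∀ {t m n} → (∀ j → ⟦ lhs (sides j) ⟧ m n t ℕ.< ⟦ rhs (sides j) ⟧ m n t) → StrictlySatisfies t (+ m , + n)
  ℕ⇒StrictlySatisfies {t} {m} {n} h j = subst₂ ℤ._<_ (sym (⟦⟧ℤ-+ (lhs (sides j)) m n t)) (sym (⟦⟧ℤ-+ (rhs (sides j)) m n t)) (ℤ.+<+ (h j))

  StrictlySatisfies⇒Satisfies : ∀ {t z} → StrictlySatisfies t z → Satisfies t z
  StrictlySatisfies⇒Satisfies h j = ℤₚ.<⇒≤ (h j)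

  pseudointegral-polygon : ∀ g i b → Realisation sides →
    (∀ t → ∃[ c ] HasCard (Satisfies t) c × 2 ℕ.* c ≡ 2 ℕ.* (g ℕ.* (t ℕ.* t)) ℕ.+ b ℕ.* (t ℕ.* suc t) ℕ.+ 2) →
    HasCard (StrictlySatisfies 1) i →
    HasCard (λ z → Satisfies 1 z × ¬ StrictlySatisfies 1 z) b →
    Σ Polygon λ P → Pseudointegral P × HasCard (λ z → InInterior P (embed z)) i × HasCard (λ z → OnBoundary P (embed z)) b
  pseudointegral-polygon g i b R counts interior boundary =
    Realise.polygon outline ,
    (1ℚ ∷ ℕ→ℚ b ℚ.* ½ ∷ ℕ→ℚ g ℚ.+ ℕ→ℚ b ℚ.* ½ ∷ [] , λ t 1≤t →
      let c , card , eq = counts t in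
      c , HasCard-⇔ (InDilate⇔ t {{ℕ.>-nonZero 1≤t}}) card , ehrhart g b c t eq) ,
    HasCard-⇔ InInterior⇔ interior ,
    HasCard-⇔ (λ z → mk⇔
      (λ (closed , ¬open) → Equivalence.to (InDilate⇔ 1 z) closed , ¬open ∘ Equivalence.from (InInterior⇔ z))
      (λ (closed , ¬open) → Equivalence.from (InDilate⇔ 1 z) closed , ¬open ∘ Equivalence.to (InInterior⇔ z)))
      boundary
    where
    open Realisation R
    InDilate⇔ : ∀ t .{{_ : NonZero t}} z → InDilate (Realise.polygon outline) (ℕ→ℚ t) (embed z) ⇔ Satisfies t z
    InDilate⇔ t z = mk⇔ (Equivalence.to (sides⇔ (Holds t z)) ∘ Equivalence.to (Realise.InDilate⇔InSides outline t z))
                        (Equivalence.from (Realise.InDilate⇔InSides outline t z) ∘ Equivalence.from (sides⇔ (Holds t z)))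
    InInterior⇔ : ∀ z → InInterior (Realise.polygon outline) (embed z) ⇔ StrictlySatisfies 1 z
    InInterior⇔ z = mk⇔ (Equivalence.to (sides⇔ (StrictlyHolds 1 z)) ∘ Equivalence.to (Realise.InInterior⇔StrictlyInSides outline z))
                        (Equivalence.from (Realise.InInterior⇔StrictlyInSides outline z) ∘ Equivalence.from (sides⇔ (StrictlyHolds 1 z)))

-- Counting lattice points row by row

sum< : ℕ → (ℕ → ℕ) → ℕ
sum< zero    f = 0
sum< (suc n) f = sum< n f + f n

sum<-cong : ∀ n {f g : ℕ → ℕ} → (∀ j → j < n → f j ≡ g j) → sum< n f ≡ sum< n g
sum<-cong zero    eq = refl
sum<-cong (suc n) eq = cong₂ _+_ (sum<-cong n (λ j j<n → eq j (m<n⇒m<1+n j<n))) (eq n (n<1+n n))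

sum<-split : ∀ m n f → sum< (m + n) f ≡ sum< m f + sum< n (λ j → f (m + j))
sum<-split m zero    f = trans (cong (λ k → sum< k f) (+-identityʳ m)) (sym (+-identityʳ _))
sum<-split m (suc n) f = begin
  sum< (m + suc n) f                                       ≡⟨ cong (λ k → sum< k f) (+-suc m n) ⟩
  sum< (m + n) f + f (m + n)                               ≡⟨ cong (_+ f (m + n)) (sum<-split m n f) ⟩
  sum< m f + sum< n (λ j → f (m + j)) + f (m + n)          ≡⟨ +-assoc (sum< m f) _ _ ⟩
  sum< m f + (sum< n (λ j → f (m + j)) + f (m + n))        ∎
  where open ≡-Reasoning

sum<-+ : ∀ n f g → sum< n (λ j → f j + g j) ≡ sum< n f + sum< n g
sum<-+ zero    f g = refl
sum<-+ (suc n) f g = trans (cong (_+ (f n + g n)) (sum<-+ n f g)) (interchange (sum< n f) (sum< n g) (f n) (g n))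
  where
  interchange : ∀ a b c d → a + b + (c + d) ≡ a + c + (b + d)
  interchange = solve-∀

sum<-* : ∀ c n f → sum< n (λ j → c * f j) ≡ c * sum< n f
sum<-* c zero    f = sym (*-zeroʳ c)
sum<-* c (suc n) f = trans (cong (_+ c * f n) (sum<-* c n f)) (sym (*-distribˡ-+ c (sum< n f) (f n)))

sum<-const : ∀ n c → sum< n (λ _ → c) ≡ n * c
sum<-const zero    c = refl
sum<-const (suc n) c = trans (cong (_+ c) (sum<-const n c)) (+-comm (n * c) c)

module _ (start len : ℕ → ℕ) where

  row : ℕ → List ℤ²
  row n = map (λ k → + (start n + k) , + n) (upTo (len n))

  rows : ℕ → List ℤ²
  rows zero    = []
  rows (suc N) = rows N ++ row N

  ∈-row⁻ : ∀ {n z} → z ∈ row n → ∃[ k ] k < len n × z ≡ (+ (start n + k) , + n)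
  ∈-row⁻ z∈ with k , k∈ , eq ← ∈-map⁻ _ z∈ = k , ∈-upTo⁻ k∈ , eq

  ∈-rows⁻ : ∀ {N z} → z ∈ rows N → ∃[ n ] n < N × z ∈ row n
  ∈-rows⁻ {suc N} z∈ with ∈-++⁻ (rows N) z∈
  ... | inj₂ z∈row = N , n<1+n N , z∈row
  ... | inj₁ z∈rows with n , n<N , z∈row ← ∈-rows⁻ {N} z∈rows = n , m<n⇒m<1+n n<N , z∈row

  ∈-rows⁺ : ∀ {n N z} → n <′ N → z ∈ row n → z ∈ rows N
  ∈-rows⁺ {N = suc N} <′-base       z∈ = ∈-++⁺ʳ (rows N) z∈
  ∈-rows⁺ {N = suc N} (≤′-step n<N) z∈ = ∈-++⁺ˡ (∈-rows⁺ n<N z∈)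

  row-unique : ∀ n → Unique (row n)
  row-unique n = Unique.map⁺ (λ eq → +-cancelˡ-≡ (start n) _ _ (ℤₚ.+-injective (cong proj₁ eq))) (Unique.upTo⁺ (len n))

  rows-unique : ∀ N → Unique (rows N)
  rows-unique zero    = AllPairs.[]
  rows-unique (suc N) = Unique.++⁺ (rows-unique N) (row-unique N) disjoint
    where
    disjoint : Disjoint (rows N) (row N)
    disjoint (z∈rows , z∈row)
      with n , n<N , z∈row′ ← ∈-rows⁻ {N} z∈rows
      with _ , _ , refl ← ∈-row⁻ {N} z∈row
      with _ , _ , eq ← ∈-row⁻ {n} z∈row′ = <⇒≢ n<N (sym (ℤₚ.+-injective (cong proj₂ eq)))

  length-rows : ∀ N → length (rows N) ≡ sum< N len
  length-rows zero    = refl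
  length-rows (suc N) = trans (length-++ (rows N))
    (cong₂ _+_ (length-rows N) (trans (length-map _ (upTo (len N))) (length-upTo (len N))))

  -- Rows are half-open intervals, so that an empty row is simply one of length 0; such rows do
  -- occur below.
  rows-HasCard : ∀ N (S : ℤ² → Set) →
    (∀ z → S z → ∃[ m ] ∃[ n ] z ≡ (+ m , + n) × n < N × start n ≤ m × m < start n + len n) →
    (∀ m n → n < N → start n ≤ m → m < start n + len n → S (+ m , + n)) →
    HasCard S (sum< N len)
  rows-HasCard N S to from = rows N , rows-unique N , (λ z → mk⇔ ∈⇒S (S⇒∈ z)) , length-rows N
    where
    ∈⇒S : ∀ {z} → z ∈ rows N → S z
    ∈⇒S z∈ with n , n<N , z∈row ← ∈-rows⁻ {N} z∈ with k , k<len , refl ← ∈-row⁻ {n} z∈row =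
      from (start n + k) n n<N (m≤m+n (start n) k) (+-monoʳ-< (start n) k<len)
    S⇒∈ : ∀ z → S z → z ∈ rows N
    S⇒∈ z z∈S with m , n , refl , n<N , s≤m , m<e ← to z z∈S = ∈-rows⁺ (<⇒<′ n<N)
      (subst (λ x → (+ x , + n) ∈ row n) (m+[n∸m]≡n s≤m)
        (∈-map⁺ _ (∈-upTo⁺ (+-cancelˡ-< (start n) _ _ (subst (_< start n + len n) (sym (m+[n∸m]≡n s≤m)) m<e)))))

-- Rounded division and linear certificates

infixl 7 _⌈/⌉_

_⌈/⌉_ : (n d : ℕ) .{{_ : NonZero d}} → ℕ
n ⌈/⌉ d = (n + pred d) / d

n≤m*d⇒n⌈/⌉d≤m : ∀ n m d .{{_ : NonZero d}} → n ≤ m * d → n ⌈/⌉ d ≤ m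
n≤m*d⇒n⌈/⌉d≤m n m (suc d) n≤ = s≤s⁻¹ (m<n*o⇒m/o<n {n + d} {suc m} {suc d}
  (subst (_≤ suc m * suc d) (cong suc (+-comm d n)) (s≤s (+-monoʳ-≤ d n≤))))

n⌈/⌉d≤m⇒n≤m*d : ∀ n m d .{{_ : NonZero d}} → n ⌈/⌉ d ≤ m → n ≤ m * d
n⌈/⌉d≤m⇒n≤m*d n m (suc d) c≤m = +-cancelʳ-≤ d n (m * suc d) (begin
  n + d                                               ≡⟨ m≡m%n+[m/n]*n (n + d) (suc d) ⟩
  (n + d) % suc d + (n + d) / suc d * suc d           ≤⟨ +-mono-≤ (s≤s⁻¹ (m%n<n (n + d) (suc d))) (*-monoˡ-≤ (suc d) c≤m) ⟩
  d + m * suc d                                       ≡⟨ +-comm d (m * suc d) ⟩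
  m * suc d + d                                       ∎)
  where open ≤-Reasoning

[k*d+m]/d : ∀ k m d .{{_ : NonZero d}} → (k * d + m) / d ≡ k + m / d
[k*d+m]/d k m d = trans (+-distrib-/-∣ˡ m (divides-refl k)) (cong (_+ m / d) (m*n/n≡m k d))
  where open import Data.Nat.Divisibility using (divides-refl)

[k*d+m]⌈/⌉d : ∀ k m d .{{_ : NonZero d}} → (k * d + m) ⌈/⌉ d ≡ k + m ⌈/⌉ d
[k*d+m]⌈/⌉d k m d = trans (cong (_/ d) (+-assoc (k * d) m (pred d))) ([k*d+m]/d k (m + pred d) d)

m*d≤n⇒m≤n/d : ∀ m n d .{{_ : NonZero d}} → m * d ≤ n → m ≤ n / d
m*d≤n⇒m≤n/d m n d h = subst (_≤ n / d) (m*n/n≡m m d) (/-monoˡ-≤ d h)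

m≤n/d⇒m*d≤n : ∀ m n d .{{_ : NonZero d}} → m ≤ n / d → m * d ≤ n
m≤n/d⇒m*d≤n m n d h = ≤-trans (*-monoˡ-≤ d h) (m/n*n≤m n d)

-- A certificate for a linear consequence l ≤ r ⇒ a ≤ b, with slack s.
≤-certificate : ∀ {l r a b} s → l ≤ r → a + r + s ≡ b + l → a ≤ b
≤-certificate {l} {r} {a} {b} s l≤r eq = +-cancelʳ-≤ r a b (begin
  a + r     ≤⟨ m≤m+n (a + r) s ⟩
  a + r + s ≡⟨ eq ⟩
  b + l     ≤⟨ +-monoʳ-≤ b l≤r ⟩
  b + r     ∎)
  where open ≤-Reasoning

≤-slack : ∀ {a b} s → a + s ≡ b → a ≤ b
≤-slack {a} s refl = m≤m+n a s

-- Closed forms for sums of integers and of ceilings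

sum<-id : ∀ n → 2 * sum< n (λ j → j) + n ≡ n * n
sum<-id zero    = refl
sum<-id (suc n) = begin
  2 * (sum< n (λ j → j) + n) + suc n             ≡⟨ regroup (sum< n (λ j → j)) n ⟩
  2 * sum< n (λ j → j) + n + suc (2 * n)         ≡⟨ cong (_+ suc (2 * n)) (sum<-id n) ⟩
  n * n + suc (2 * n)                            ≡⟨ solve (n ∷ []) ⟩
  suc n * suc n                                  ∎
  where
  open ≡-Reasoning
  regroup : ∀ s n → 2 * (s + n) + suc n ≡ 2 * s + n + suc (2 * n)
  regroup = solve-∀

sum<-∸ : ∀ n → 2 * sum< n (n ∸_) ≡ n * suc n
sum<-∸ zero    = refl
sum<-∸ (suc n) = begin
  2 * (sum< n (suc n ∸_) + (suc n ∸ n))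
    ≡⟨ cong₂ (λ a b → 2 * (a + b)) (sum<-cong n (λ j j<n → +-∸-assoc 1 (<⇒≤ j<n))) (m+n∸n≡m 1 n) ⟩
  2 * (sum< n (λ j → 1 + (n ∸ j)) + 1)
    ≡⟨ cong (λ a → 2 * (a + 1)) (sum<-+ n (λ _ → 1) (n ∸_)) ⟩
  2 * (sum< n (λ _ → 1) + sum< n (n ∸_) + 1)
    ≡⟨ cong (λ a → 2 * (a + sum< n (n ∸_) + 1)) (sum<-const n 1) ⟩
  2 * (n * 1 + sum< n (n ∸_) + 1)
    ≡⟨ regroup n (sum< n (n ∸_)) ⟩
  2 * sum< n (n ∸_) + 2 * suc n
    ≡⟨ cong (_+ 2 * suc n) (sum<-∸ n) ⟩
  n * suc n + 2 * suc n
    ≡⟨ solve (n ∷ []) ⟩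
  suc n * suc (suc n) ∎
  where
  open ≡-Reasoning
  regroup : ∀ n s → 2 * (n * 1 + s + 1) ≡ 2 * s + 2 * suc n
  regroup = solve-∀

-- Over an even number and its successor the rounding errors of quarters have a constant total,
-- since j ↦ j + 2 raises both ceilings by one. Hence prefix sums of even length are polynomial;
-- those of odd length need not be.
⌈/4⌉-pair : ∀ j → (2 * j) ⌈/⌉ 4 + suc (2 * j) ⌈/⌉ 4 ≡ suc j
⌈/4⌉-pair zero          = refl
⌈/4⌉-pair (suc zero)    = refl
⌈/4⌉-pair (suc (suc j)) = begin
  (2 * suc (suc j)) ⌈/⌉ 4 + suc (2 * suc (suc j)) ⌈/⌉ 4
    ≡⟨ cong (λ e → e ⌈/⌉ 4 + suc e ⌈/⌉ 4) (*-distribˡ-+ 2 2 j) ⟩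
  (4 + 2 * j) ⌈/⌉ 4 + (4 + suc (2 * j)) ⌈/⌉ 4
    ≡⟨ cong₂ _+_ ([k*d+m]⌈/⌉d 1 (2 * j) 4) ([k*d+m]⌈/⌉d 1 (suc (2 * j)) 4) ⟩
  suc ((2 * j) ⌈/⌉ 4) + suc (suc (2 * j) ⌈/⌉ 4)
    ≡⟨ cong suc (+-suc ((2 * j) ⌈/⌉ 4) (suc (2 * j) ⌈/⌉ 4)) ⟩
  2 + ((2 * j) ⌈/⌉ 4 + suc (2 * j) ⌈/⌉ 4)
    ≡⟨ cong (λ w → 2 + w) (⌈/4⌉-pair j) ⟩
  suc (suc (suc j)) ∎
  where open ≡-Reasoning

sum<-⌈/4⌉ : ∀ n → 2 * sum< (2 * n) (_⌈/⌉ 4) ≡ n * suc n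
sum<-⌈/4⌉ zero    = refl
sum<-⌈/4⌉ (suc n) = begin
  2 * sum< (2 * suc n) (_⌈/⌉ 4)
    ≡⟨ cong (λ e → 2 * sum< e (_⌈/⌉ 4)) (double-suc n) ⟩
  2 * (sum< (2 * n) (_⌈/⌉ 4) + (2 * n) ⌈/⌉ 4 + suc (2 * n) ⌈/⌉ 4)
    ≡⟨ regroup (sum< (2 * n) (_⌈/⌉ 4)) _ _ ⟩
  2 * sum< (2 * n) (_⌈/⌉ 4) + 2 * ((2 * n) ⌈/⌉ 4 + suc (2 * n) ⌈/⌉ 4)
    ≡⟨ cong₂ (λ a b → a + 2 * b) (sum<-⌈/4⌉ n) (⌈/4⌉-pair n) ⟩
  n * suc n + 2 * suc n
    ≡⟨ solve (n ∷ []) ⟩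
  suc n * suc (suc n) ∎
  where
  open ≡-Reasoning
  double-suc : ∀ n → 2 * suc n ≡ suc (suc (2 * n))
  double-suc = solve-∀
  regroup : ∀ s a b → 2 * (s + a + b) ≡ 2 * s + 2 * (a + b)
  regroup = solve-∀

-- The modulus 16 comes from 3t + k + 1 = 16k + 3r + 1 for t = r + 5k. The block of 16k terms has
-- even length, and 4 divides 16k, so the tail is the initial segment raised by 4k.
sum<-⌈/4⌉-16k+ : ∀ k s → 2 * sum< (16 * k + s) (_⌈/⌉ 4)
  ≡ 8 * k * suc (8 * k) + 2 * (s * (4 * k) + sum< s (_⌈/⌉ 4))
sum<-⌈/4⌉-16k+ k s = begin
  2 * sum< (16 * k + s) (_⌈/⌉ 4)
    ≡⟨ cong (2 *_) (sum<-split (16 * k) s (_⌈/⌉ 4)) ⟩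
  2 * (sum< (16 * k) (_⌈/⌉ 4) + sum< s (λ j → (16 * k + j) ⌈/⌉ 4))
    ≡⟨ *-distribˡ-+ 2 (sum< (16 * k) (_⌈/⌉ 4)) _ ⟩
  2 * sum< (16 * k) (_⌈/⌉ 4) + 2 * sum< s (λ j → (16 * k + j) ⌈/⌉ 4)
    ≡⟨ cong₂ (λ a b → 2 * sum< a (_⌈/⌉ 4) + 2 * b) (halve k)
         (sum<-cong s (λ j _ → trans (cong (λ e → (e + j) ⌈/⌉ 4) (quarter k)) ([k*d+m]⌈/⌉d (4 * k) j 4))) ⟩
  2 * sum< (2 * (8 * k)) (_⌈/⌉ 4) + 2 * sum< s (λ j → 4 * k + j ⌈/⌉ 4)
    ≡⟨ cong (_+ 2 * sum< s (λ j → 4 * k + j ⌈/⌉ 4)) (sum<-⌈/4⌉ (8 * k)) ⟩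
  8 * k * suc (8 * k) + 2 * sum< s (λ j → 4 * k + j ⌈/⌉ 4)
    ≡⟨ cong (λ e → 8 * k * suc (8 * k) + 2 * e)
         (trans (sum<-+ s (λ _ → 4 * k) (_⌈/⌉ 4)) (cong (_+ sum< s (_⌈/⌉ 4)) (sum<-const s (4 * k)))) ⟩
  8 * k * suc (8 * k) + 2 * (s * (4 * k) + sum< s (_⌈/⌉ 4)) ∎
  where
  open ≡-Reasoning
  halve : ∀ k → 16 * k ≡ 2 * (8 * k)
  halve = solve-∀
  quarter : ∀ k → 16 * k ≡ 4 * k * 4
  quarter = solve-∀

-- The lattice points of the triangle 0 ≤ y, y + 2t ≤ 4x, x + 6y ≤ 8t number (9t² + 9t + 2) / 2;
-- this is that count with the linear parts of the row lengths already summed.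
sum<-starts : ∀ k (r : Fin 5) → let t = toℕ r + k * 5 in
  2 * sum< (t + suc k) (λ j → (2 * t + j) ⌈/⌉ 4) + 6 * (k * suc k) + t * suc t + 2
  ≡ 2 * (t * t) + 4 * (suc k * t) + 2 * suc k
sum<-starts k r = begin
  2 * Q + 6 * (k * suc k) + t * suc t + 2
    -- The row starts are the terms ⌈j/4⌉ with 2t ≤ j < 3t + k + 1. Trading t (t + 1) for twice the
    -- missing initial segment `P` completes them to a prefix sum.
    ≡⟨ cong (λ e → 2 * Q + 6 * (k * suc k) + e + 2) (sum<-⌈/4⌉ t) ⟨
  2 * Q + 6 * (k * suc k) + 2 * P + 2
    ≡⟨ regroup Q P (6 * (k * suc k)) ⟩
  2 * (P + Q) + 6 * (k * suc k) + 2
    ≡⟨ cong (λ e → 2 * e + 6 * (k * suc k) + 2) (sum<-split (2 * t) (t + suc k) (_⌈/⌉ 4)) ⟨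
  2 * sum< (2 * t + (t + suc k)) (_⌈/⌉ 4) + 6 * (k * suc k) + 2
    ≡⟨ cong (λ e → 2 * sum< e (_⌈/⌉ 4) + 6 * (k * suc k) + 2) (length≡ k (toℕ r)) ⟩
  2 * sum< (16 * k + suc (3 * toℕ r)) (_⌈/⌉ 4) + 6 * (k * suc k) + 2
    ≡⟨ cong (λ e → e + 6 * (k * suc k) + 2) (sum<-⌈/4⌉-16k+ k (suc (3 * toℕ r))) ⟩
  8 * k * suc (8 * k) + 2 * (suc (3 * toℕ r) * (4 * k) + sum< (suc (3 * toℕ r)) (_⌈/⌉ 4)) + 6 * (k * suc k) + 2
    ≡⟨ residues r ⟩
  2 * (t * t) + 4 * (suc k * t) + 2 * suc k ∎
  where
  open ≡-Reasoning
  t = toℕ r + k * 5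
  P = sum< (2 * t) (_⌈/⌉ 4)
  Q = sum< (t + suc k) (λ j → (2 * t + j) ⌈/⌉ 4)
  regroup : ∀ q p e → 2 * q + e + 2 * p + 2 ≡ 2 * (p + q) + e + 2
  regroup = solve-∀
  length≡ : ∀ k r → 2 * (r + k * 5) + (r + k * 5 + suc k) ≡ 16 * k + suc (3 * r)
  length≡ = solve-∀
  residues : ∀ r → let t = toℕ r + k * 5 in
    8 * k * suc (8 * k) + 2 * (suc (3 * toℕ r) * (4 * k) + sum< (suc (3 * toℕ r)) (_⌈/⌉ 4)) + 6 * (k * suc k) + 2
    ≡ 2 * (t * t) + 4 * (suc k * t) + 2 * suc k
  -- The constants 0, 3, 8, 15, 24 in the five cases are the evaluated sums of the first 3r + 1
  -- ceilings.
  residues 0F = identity k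
    where
    identity : ∀ k → 8 * k * suc (8 * k) + 2 * (1 * (4 * k) + 0) + 6 * (k * suc k) + 2
      ≡ 2 * ((0 + k * 5) * (0 + k * 5)) + 4 * (suc k * (0 + k * 5)) + 2 * suc k
    identity = solve-∀
  residues 1F = identity k
    where
    identity : ∀ k → 8 * k * suc (8 * k) + 2 * (4 * (4 * k) + 3) + 6 * (k * suc k) + 2
      ≡ 2 * ((1 + k * 5) * (1 + k * 5)) + 4 * (suc k * (1 + k * 5)) + 2 * suc k
    identity = solve-∀
  residues 2F = identity k
    where
    identity : ∀ k → 8 * k * suc (8 * k) + 2 * (7 * (4 * k) + 8) + 6 * (k * suc k) + 2
      ≡ 2 * ((2 + k * 5) * (2 + k * 5)) + 4 * (suc k * (2 + k * 5)) + 2 * suc k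
    identity = solve-∀
  residues 3F = identity k
    where
    identity : ∀ k → 8 * k * suc (8 * k) + 2 * (10 * (4 * k) + 15) + 6 * (k * suc k) + 2
      ≡ 2 * ((3 + k * 5) * (3 + k * 5)) + 4 * (suc k * (3 + k * 5)) + 2 * suc k
    identity = solve-∀
  residues 4F = identity k
    where
    identity : ∀ k → 8 * k * suc (8 * k) + 2 * (13 * (4 * k) + 24) + 6 * (k * suc k) + 2
      ≡ 2 * ((4 + k * 5) * (4 + k * 5)) + 4 * (suc k * (4 + k * 5)) + 2 * suc k
    identity = solve-∀

-- Row ends and row lengths for b ≥ 2

module WideRows (g c : ℕ) where

  -- The right end from the overview for δ = 8 + 5g - c, arranged so that only rows above t subtract
  -- anything. Without g, it goes linearly from c t in row 0 to 2t in row t.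
  rowEnd : ℕ → ℕ → ℕ
  rowEnd t n = c * (t ∸ n) + 2 * (t ⊓ n) + g * (t ⊓ (5 * n)) ∸ (6 + 5 * g) * (n ∸ t)

  rowEnd-lower : ∀ n a → rowEnd (n + a) n ≡ c * a + 2 * n + g * ((n + a) ⊓ (5 * n))
  rowEnd-lower n a = begin
    c * (n + a ∸ n) + 2 * ((n + a) ⊓ n) + g * ((n + a) ⊓ (5 * n)) ∸ (6 + 5 * g) * (n ∸ (n + a))
      ≡⟨ cong₂ (λ u v → u ∸ (6 + 5 * g) * v)
           (cong₂ (λ u v → c * u + 2 * v + g * ((n + a) ⊓ (5 * n))) (m+n∸m≡n n a) (m≥n⇒m⊓n≡n (m≤m+n n a)))
           (m≤n⇒m∸n≡0 (m≤m+n n a)) ⟩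
    c * a + 2 * n + g * ((n + a) ⊓ (5 * n)) ∸ (6 + 5 * g) * 0
      ≡⟨ cong (c * a + 2 * n + g * ((n + a) ⊓ (5 * n)) ∸_) (*-zeroʳ (6 + 5 * g)) ⟩
    c * a + 2 * n + g * ((n + a) ⊓ (5 * n)) ∎
    where open ≡-Reasoning

  rowEnd-upper : ∀ t b → rowEnd t (t + b) ≡ 2 * t + g * t ∸ (6 + 5 * g) * b
  rowEnd-upper t b = begin
    c * (t ∸ (t + b)) + 2 * (t ⊓ (t + b)) + g * (t ⊓ (5 * (t + b))) ∸ (6 + 5 * g) * (t + b ∸ t)
      ≡⟨ cong₂ (λ u v → u ∸ (6 + 5 * g) * v)
           (cong₂ _+_ (cong₂ (λ u v → c * u + 2 * v) (m≤n⇒m∸n≡0 (m≤m+n t b)) (m≤n⇒m⊓n≡m (m≤m+n t b)))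
                      (cong (g *_) (m≤n⇒m⊓n≡m (≤-trans (m≤m+n t b) (m≤n*m (t + b) 5)))))
           (m+n∸m≡n t b) ⟩
    c * 0 + 2 * t + g * t ∸ (6 + 5 * g) * b
      ≡⟨ cong (λ e → e + 2 * t + g * t ∸ (6 + 5 * g) * b) (*-zeroʳ c) ⟩
    2 * t + g * t ∸ (6 + 5 * g) * b ∎
    where open ≡-Reasoning

  -- Row t + b lies in the polygon only if 5b ≤ t; multiplied by 2 + g this is the claim. It makes
  -- the truncated subtraction in `rowEnd` a true one.
  upper-room : ∀ t b → 5 * (t + b) ≤ 6 * t → (6 + 5 * g) * b + 4 * b ≤ 2 * t + g * t
  upper-room t b h = ≤-certificate 0 (*-monoʳ-≤ (2 + g) h) (identity g t b)
    where
    identity : ∀ g t b → (6 + 5 * g) * b + 4 * b + (2 + g) * (6 * t) + 0 ≡ 2 * t + g * t + (2 + g) * (5 * (t + b))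
    identity = solve-∀

  module _ (c≤ : c ≤ 8 + 5 * g) where

    ≤rowEnd : ∀ t m n → 5 * n ≤ 6 * t →
      m + c * n ≤ (2 + 5 * g) * n + c * t →
      m + c * n ≤ 2 * n + (c + g) * t →
      m + (6 + 5 * g) * n ≤ (8 + 6 * g) * t →
      m ≤ rowEnd t n
    ≤rowEnd t m n 5n≤6t e₂ e₃ e₄ with ≤-total n t
    ... | inj₁ n≤t with a , refl ← m≤n⇒∃[o]m+o≡n n≤t = subst (m ≤_) (sym (rowEnd-lower n a)) (lower (≤-total (n + a) (5 * n)))
      where
      identity₂ : ∀ c g m n a → m + ((2 + 5 * g) * n + c * (n + a)) + 0 ≡ c * a + 2 * n + g * (5 * n) + (m + c * n)
      identity₂ = solve-∀
      identity₃ : ∀ c g m n a → m + (2 * n + (c + g) * (n + a)) + 0 ≡ c * a + 2 * n + g * (n + a) + (m + c * n)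
      identity₃ = solve-∀
      lower : _ → m ≤ c * a + 2 * n + g * ((n + a) ⊓ (5 * n))
      lower (inj₁ t≤5n) rewrite m≤n⇒m⊓n≡m t≤5n = ≤-certificate 0 e₃ (identity₃ c g m n a)
      lower (inj₂ 5n≤t) rewrite m≥n⇒m⊓n≡n 5n≤t = ≤-certificate 0 e₂ (identity₂ c g m n a)
    ... | inj₂ t≤n with b , refl ← m≤n⇒∃[o]m+o≡n t≤n = subst (m ≤_) (sym (rowEnd-upper t b))
      (m+n≤o⇒m≤o∸n m (≤-certificate 0 e₄ (identity g m t b)))
      where
      identity : ∀ g m t b → m + (6 + 5 * g) * b + (8 + 6 * g) * t + 0 ≡ 2 * t + g * t + (m + (6 + 5 * g) * (t + b))
      identity = solve-∀

    -- Each row end lies on one of the three right sides, and the other two follow from concavity of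
    -- the edge path: at height t/5 this is the minimum in `rowEnd`, at height t it is
    -- `c ≤ 8 + 5 * g`, that is, δ ≥ 0.
    ≤rowEnd⁻¹ : ∀ t m n → 5 * n ≤ 6 * t → m ≤ rowEnd t n →
      m + c * n ≤ (2 + 5 * g) * n + c * t ×
      m + c * n ≤ 2 * n + (c + g) * t ×
      m + (6 + 5 * g) * n ≤ (8 + 6 * g) * t
    ≤rowEnd⁻¹ t m n 5n≤6t m≤ with ≤-total n t
    ... | inj₁ n≤t with a , refl ← m≤n⇒∃[o]m+o≡n n≤t =
      ≤-certificate 0 (+-mono-≤ m≤′ (*-monoʳ-≤ g (m⊓n≤n (n + a) (5 * n)))) (identity₂ c g m n a w) ,
      ≤-certificate 0 (+-mono-≤ m≤′ (*-monoʳ-≤ g (m⊓n≤m (n + a) (5 * n)))) (identity₃ c g m n a w) ,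
      ≤-certificate 0 (+-mono-≤ (+-mono-≤ m≤′ (*-monoˡ-≤ a c≤))
          (*-monoʳ-≤ g (+-mono-≤ (m⊓n≤m (n + a) (5 * n)) (z≤n {0}))))
        (identity₄ c g m n a w)
      where
      w = (n + a) ⊓ (5 * n)
      m≤′ = subst (m ≤_) (rowEnd-lower n a) m≤
      identity₂ : ∀ c g m n a w → m + c * n + (c * a + 2 * n + g * w + g * (5 * n)) + 0
        ≡ (2 + 5 * g) * n + c * (n + a) + (m + g * w)
      identity₂ = solve-∀
      identity₃ : ∀ c g m n a w → m + c * n + (c * a + 2 * n + g * w + g * (n + a)) + 0
        ≡ 2 * n + (c + g) * (n + a) + (m + g * w)
      identity₃ = solve-∀
      identity₄ : ∀ c g m n a w → m + (6 + 5 * g) * n + (c * a + 2 * n + g * w + (8 + 5 * g) * a + g * (n + a + 0)) + 0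
        ≡ (8 + 6 * g) * (n + a) + (m + c * a + g * (w + 0))
      identity₄ = solve-∀
    ... | inj₂ t≤n with b , refl ← m≤n⇒∃[o]m+o≡n t≤n =
      ≤-certificate (4 * (g * t) + 5 * (g * b) + 0) (+-mono-≤ m≤′ (*-monoˡ-≤ b c≤)) (identity₂ c g m t b) ,
      ≤-certificate 0 (+-mono-≤ m≤′ (*-monoˡ-≤ b c≤)) (identity₃ c g m t b) ,
      ≤-certificate 0 m≤′ (identity₄ g m t b)
      where
      m≤′ : m + (6 + 5 * g) * b ≤ 2 * t + g * t
      m≤′ = subst (m + (6 + 5 * g) * b ≤_) (m∸n+n≡m (m+n≤o⇒m≤o ((6 + 5 * g) * b) (upper-room t b 5n≤6t)))
        (+-monoˡ-≤ ((6 + 5 * g) * b) (subst (m ≤_) (rowEnd-upper t b) m≤))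
      identity₂ : ∀ c g m t b → m + c * (t + b) + (2 * t + g * t + (8 + 5 * g) * b) + (4 * (g * t) + 5 * (g * b) + 0)
        ≡ (2 + 5 * g) * (t + b) + c * t + (m + (6 + 5 * g) * b + c * b)
      identity₂ = solve-∀
      identity₃ : ∀ c g m t b → m + c * (t + b) + (2 * t + g * t + (8 + 5 * g) * b) + 0
        ≡ 2 * (t + b) + (c + g) * t + (m + (6 + 5 * g) * b + c * b)
      identity₃ = solve-∀
      identity₄ : ∀ g m t b → m + (6 + 5 * g) * (t + b) + (2 * t + g * t) + 0
        ≡ (8 + 6 * g) * t + (m + (6 + 5 * g) * b)
      identity₄ = solve-∀

  -- No row is empty, since row ends are integers. Up to height t this rests on c ≥ 1, hence on b ≥
  -- 2; above it the left and right edges first meet at the apex, at height 6t/5.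
  start≤rowEnd : .{{_ : NonZero c}} → ∀ t n → 5 * n ≤ 6 * t → 2 * t + n ≤ rowEnd t n * 4
  start≤rowEnd t n 5n≤6t with ≤-total n t
  ... | inj₁ n≤t with a , refl ← m≤n⇒∃[o]m+o≡n n≤t = subst (λ e → 2 * (n + a) + n ≤ e * 4) (sym (rowEnd-lower n a))
    (≤-certificate (2 * a + 5 * n + g * w * 4) (*-monoˡ-≤ (4 * a) (>-nonZero⁻¹ c)) (identity c g n a w))
    where
    w = (n + a) ⊓ (5 * n)
    identity : ∀ c g n a w → 2 * (n + a) + n + c * (4 * a) + (2 * a + 5 * n + g * w * 4)
      ≡ (c * a + 2 * n + g * w) * 4 + 1 * (4 * a)
    identity = solve-∀
  ... | inj₂ t≤n with b , refl ← m≤n⇒∃[o]m+o≡n t≤n = subst (λ e → 2 * t + (t + b) ≤ e * 4) (sym (rowEnd-upper t b))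
    (subst (2 * t + (t + b) ≤_) (sym (*-distribʳ-∸ 4 (2 * t + g * t) ((6 + 5 * g) * b)))
      (m+n≤o⇒m≤o∸n _ (≤-certificate 0 (*-monoʳ-≤ (5 + 4 * g) 5n≤6t) (identity g t b))))
    where
    identity : ∀ g t b → 2 * t + (t + b) + (6 + 5 * g) * b * 4 + (5 + 4 * g) * (6 * t) + 0
      ≡ (2 * t + g * t) * 4 + (5 + 4 * g) * (5 * (t + b))
    identity = solve-∀

  -- Four times the top right side plus the left side eliminates the abscissa; what remains is 5 +
  -- 4g times the height bound.
  5n≤6t : ∀ t m n → m + (6 + 5 * g) * n ≤ (8 + 6 * g) * t → n + 2 * t ≤ 4 * m → 5 * n ≤ 6 * t
  5n≤6t t m n e₄ e₅ = *-cancelˡ-≤ (5 + 4 * g) (≤-certificate 0 (+-mono-≤ (*-monoʳ-≤ 4 e₄) e₅) (identity g t m n))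
    where
    identity : ∀ g t m n → (5 + 4 * g) * (5 * n) + (4 * ((8 + 6 * g) * t) + 4 * m) + 0
      ≡ (5 + 4 * g) * (6 * t) + (4 * (m + (6 + 5 * g) * n) + (n + 2 * t))
    identity = solve-∀

  rowEnd-room : ∀ t n → 5 * n ≤ 6 * t →
    (6 + 5 * g) * (n ∸ t) ≤ c * (t ∸ n) + 2 * (t ⊓ n) + g * (t ⊓ (5 * n))
  rowEnd-room t n 5n≤6t with ≤-total n t
  ... | inj₁ n≤t rewrite m≤n⇒m∸n≡0 n≤t | *-zeroʳ (6 + 5 * g) = z≤n
  ... | inj₂ t≤n with b , refl ← m≤n⇒∃[o]m+o≡n t≤n = begin
    (6 + 5 * g) * (t + b ∸ t)               ≡⟨ cong ((6 + 5 * g) *_) (m+n∸m≡n t b) ⟩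
    (6 + 5 * g) * b                         ≤⟨ m+n≤o⇒m≤o ((6 + 5 * g) * b) (upper-room t b 5n≤6t) ⟩
    2 * t + g * t                           ≡⟨ cong₂ (λ u v → 2 * u + g * v) (m≤n⇒m⊓n≡m t≤n)
                                                 (m≤n⇒m⊓n≡m (≤-trans t≤n (m≤n*m (t + b) 5))) ⟨
    2 * (t ⊓ (t + b)) + g * (t ⊓ (5 * (t + b)))
                                            ≤⟨ +-monoˡ-≤ _ (m≤n+m (2 * (t ⊓ (t + b))) (c * (t ∸ (t + b)))) ⟩
    c * (t ∸ (t + b)) + 2 * (t ⊓ (t + b)) + g * (t ⊓ (5 * (t + b))) ∎
    where open ≤-Reasoning

  -- Writing t = r + 5k makes both floors explicit: ⌊t/5⌋ = k, and the rows are 0, ..., t + k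
  -- because ⌊6t/5⌋ = t + k.
  module _ (k : ℕ) (r : Fin 5) where

    private
      t N : ℕ
      t = toℕ r + k * 5
      N = t + suc k

    n<N⇒5n≤6t : ∀ n → n < N → 5 * n ≤ 6 * t
    n<N⇒5n≤6t n n<N = ≤-certificate (toℕ r) (*-monoʳ-≤ 5 (s≤s⁻¹ (subst (n <_) (+-suc t k) n<N))) (identity n k (toℕ r))
      where
      identity : ∀ n k r → 5 * n + 5 * (r + k * 5 + k) + r ≡ 6 * (r + k * 5) + 5 * n
      identity = solve-∀

    5n≤6t⇒n<N : ∀ n → 5 * n ≤ 6 * t → n < N
    5n≤6t⇒n<N n h = *-cancelˡ-< 5 n N (≤-certificate 0 (+-mono-≤ h (toℕ<n r)) (identity n k (toℕ r)))
      where
      identity : ∀ n k r → suc (5 * n) + (6 * (r + k * 5) + 5) + 0 ≡ 5 * (r + k * 5 + suc k) + (5 * n + suc r)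
      identity = solve-∀

    private
      σ τ π : ℕ
      σ = sum< (suc k) (λ j → j)
      τ = sum< t (t ∸_)
      π = sum< t (λ j → j)

      sum-∸ʳ : sum< N (_∸ t) ≡ σ
      sum-∸ʳ = trans (sum<-split t (suc k) (_∸ t)) (cong₂ _+_
        (trans (sum<-cong t (λ j j<t → m≤n⇒m∸n≡0 (<⇒≤ j<t))) (trans (sum<-const t 0) (*-zeroʳ t)))
        (sum<-cong (suc k) (λ j _ → m+n∸m≡n t j)))

      sum-∸ˡ : sum< N (t ∸_) ≡ τ
      sum-∸ˡ = trans (sum<-split t (suc k) (t ∸_)) (trans (cong (λ w → τ + w)
        (trans (sum<-cong (suc k) (λ j _ → m≤n⇒m∸n≡0 (m≤m+n t j))) (trans (sum<-const (suc k) 0) (*-zeroʳ k))))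
        (+-identityʳ τ))

      sum-⊓ : sum< N (t ⊓_) ≡ π + suc k * t
      sum-⊓ = trans (sum<-split t (suc k) (t ⊓_)) (cong₂ _+_
        (sum<-cong t (λ j j<t → m≥n⇒m⊓n≡n (<⇒≤ j<t)))
        (trans (sum<-cong (suc k) (λ j _ → m≤n⇒m⊓n≡m (m≤m+n t j))) (sum<-const (suc k) t)))

      -- The bend at t/5 falls between rows k and k + 1: it leaves k + 1 rows with 5j and t rows
      -- with t. The resulting 5σ is the counterpart of `sum-∸ʳ`.
      sum-⊓5 : sum< N (λ n → t ⊓ (5 * n)) ≡ 5 * σ + t * t
      sum-⊓5 = trans (cong (λ e → sum< e (λ n → t ⊓ (5 * n))) (+-comm t (suc k)))
        (trans (sum<-split (suc k) t (λ n → t ⊓ (5 * n))) (cong₂ _+_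
          (trans (sum<-cong (suc k) (λ j j≤k → m≥n⇒m⊓n≡n (below j (s≤s⁻¹ j≤k)))) (sum<-* 5 (suc k) (λ j → j)))
          (trans (sum<-cong t (λ j _ → m≤n⇒m⊓n≡m (above j))) (sum<-const t t))))
        where
        below : ∀ j → j ≤ k → 5 * j ≤ t
        below j j≤k = ≤-certificate (toℕ r) (*-monoʳ-≤ 5 j≤k) (identity j k (toℕ r))
          where
          identity : ∀ j k r → 5 * j + 5 * k + r ≡ r + k * 5 + 5 * j
          identity = solve-∀
        above : ∀ j → t ≤ 5 * (suc k + j)
        above j = ≤-certificate (5 * j) (<⇒≤ (toℕ<n r)) (identity j k (toℕ r))
          where
          identity : ∀ j k r → r + k * 5 + 5 + 5 * j ≡ 5 * (suc k + j) + r
          identity = solve-∀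

    -- This is where the fractional bends cancel: 5gσ is gained by the lowest k + 1 rows and lost by
    -- the highest k + 1 rows. The term with k that survives does not involve g; it belongs to the
    -- base triangle.
    sum<-rowEnd : 2 * sum< N (rowEnd t) + 6 * (k * suc k) + 2 * t
      ≡ c * (t * suc t) + 2 * (t * t) + 4 * (suc k * t) + 2 * (g * (t * t))
    -- The summand 10gσ is the cancelling pair, doubled; 6 (k + 1) turns 6k (k + 1) into 6 (k + 1)²,
    -- the form in which `sum<-id` delivers σ.
    sum<-rowEnd = +-cancelʳ-≡ (6 * suc k + 10 * (g * σ)) _ _ (begin
      2 * H + 6 * (k * suc k) + 2 * t + (6 * suc k + 10 * (g * σ))
        ≡⟨ step₁ g H k t σ ⟩
      2 * H + 6 * (suc k * suc k) + 2 * t + 10 * (g * σ)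
        ≡⟨ cong (λ e → 2 * H + 6 * e + 2 * t + 10 * (g * σ)) (sum<-id (suc k)) ⟨
      2 * H + 6 * (2 * σ + suc k) + 2 * t + 10 * (g * σ)
        ≡⟨ step₂ g H k t σ ⟩
      2 * (H + (6 + 5 * g) * σ) + 2 * t + 6 * suc k
        ≡⟨ cong (λ e → 2 * e + 2 * t + 6 * suc k) total ⟩
      2 * (c * τ + 2 * (π + suc k * t) + g * (5 * σ + t * t)) + 2 * t + 6 * suc k
        ≡⟨ step₃ g c k t σ τ π ⟩
      c * (2 * τ) + 2 * (2 * π + t) + 4 * (suc k * t) + 2 * (g * (t * t)) + (6 * suc k + 10 * (g * σ))
        ≡⟨ cong₂ (λ u v → c * u + 2 * v + 4 * (suc k * t) + 2 * (g * (t * t)) + (6 * suc k + 10 * (g * σ)))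
             (sum<-∸ t) (sum<-id t) ⟩
      c * (t * suc t) + 2 * (t * t) + 4 * (suc k * t) + 2 * (g * (t * t)) + (6 * suc k + 10 * (g * σ)) ∎)
      where
      open ≡-Reasoning
      H = sum< N (rowEnd t)
      step₁ : ∀ g H k t σ → 2 * H + 6 * (k * suc k) + 2 * t + (6 * suc k + 10 * (g * σ))
        ≡ 2 * H + 6 * (suc k * suc k) + 2 * t + 10 * (g * σ)
      step₁ = solve-∀
      step₂ : ∀ g H k t σ → 2 * H + 6 * (2 * σ + suc k) + 2 * t + 10 * (g * σ)
        ≡ 2 * (H + (6 + 5 * g) * σ) + 2 * t + 6 * suc k
      step₂ = solve-∀
      step₃ : ∀ g c k t σ τ π → 2 * (c * τ + 2 * (π + suc k * t) + g * (5 * σ + t * t)) + 2 * t + 6 * suc k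
        ≡ c * (2 * τ) + 2 * (2 * π + t) + 4 * (suc k * t) + 2 * (g * (t * t)) + (6 * suc k + 10 * (g * σ))
      step₃ = solve-∀
      total : H + (6 + 5 * g) * σ ≡ c * τ + 2 * (π + suc k * t) + g * (5 * σ + t * t)
      total = begin
        H + (6 + 5 * g) * σ
          ≡⟨ cong (λ e → H + (6 + 5 * g) * e) sum-∸ʳ ⟨
        H + (6 + 5 * g) * sum< N (_∸ t)
          ≡⟨ cong (λ w → H + w) (sum<-* (6 + 5 * g) N (_∸ t)) ⟨
        H + sum< N (λ n → (6 + 5 * g) * (n ∸ t))
          ≡⟨ sum<-+ N (rowEnd t) (λ n → (6 + 5 * g) * (n ∸ t)) ⟨
        sum< N (λ n → rowEnd t n + (6 + 5 * g) * (n ∸ t))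
          ≡⟨ sum<-cong N (λ n n<N → m∸n+n≡m (rowEnd-room t n (n<N⇒5n≤6t n n<N))) ⟩
        sum< N (λ n → c * (t ∸ n) + 2 * (t ⊓ n) + g * (t ⊓ (5 * n)))
          ≡⟨ sum<-+ N (λ n → c * (t ∸ n) + 2 * (t ⊓ n)) (λ n → g * (t ⊓ (5 * n))) ⟩
        sum< N (λ n → c * (t ∸ n) + 2 * (t ⊓ n)) + sum< N (λ n → g * (t ⊓ (5 * n)))
          ≡⟨ cong₂ _+_ (sum<-+ N (λ n → c * (t ∸ n)) (λ n → 2 * (t ⊓ n))) (sum<-* g N (λ n → t ⊓ (5 * n))) ⟩
        sum< N (λ n → c * (t ∸ n)) + sum< N (λ n → 2 * (t ⊓ n)) + g * sum< N (λ n → t ⊓ (5 * n))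
          ≡⟨ cong₂ (λ u v → u + v + g * sum< N (λ n → t ⊓ (5 * n)))
               (sum<-* c N (t ∸_)) (sum<-* 2 N (t ⊓_)) ⟩
        c * sum< N (t ∸_) + 2 * sum< N (t ⊓_) + g * sum< N (λ n → t ⊓ (5 * n))
          ≡⟨ cong₂ (λ u v → u + g * v) (cong₂ (λ u v → c * u + 2 * v) sum-∸ˡ sum-⊓) sum-⊓5 ⟩
        c * τ + 2 * (π + suc k * t) + g * (5 * σ + t * t) ∎

    rowStart rowLength : ℕ → ℕ
    rowStart n = (2 * t + n) ⌈/⌉ 4
    rowLength n = suc (rowEnd t n) ∸ rowStart n

    rowStart+rowLength : .{{_ : NonZero c}} → ∀ n → n < N → rowStart n + rowLength n ≡ suc (rowEnd t n)
    rowStart+rowLength n n<N = m+[n∸m]≡n (m≤n⇒m≤1+n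
      (n≤m*d⇒n⌈/⌉d≤m (2 * t + n) (rowEnd t n) 4 (start≤rowEnd t n (n<N⇒5n≤6t n n<N))))

    sum<-rowLength : .{{_ : NonZero c}} →
      2 * sum< N rowLength ≡ 2 * (g * (t * t)) + suc c * (t * suc t) + 2
    sum<-rowLength = +-cancelʳ-≡ (2 * Q + 6 * (k * suc k) + 2 * t + 2 * suc k) _ _ (begin
      2 * L + (2 * Q + 6 * (k * suc k) + 2 * t + 2 * suc k)
        ≡⟨ step₁ L Q k t ⟩
      2 * (Q + L) + 6 * (k * suc k) + 2 * t + 2 * suc k
        ≡⟨ cong (λ e → 2 * e + 6 * (k * suc k) + 2 * t + 2 * suc k) total ⟩
      2 * (N * 1 + H) + 6 * (k * suc k) + 2 * t + 2 * suc k
        ≡⟨ step₂ H k t ⟩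
      (2 * H + 6 * (k * suc k) + 2 * t) + 2 * t + 4 * suc k
        ≡⟨ cong (λ e → e + 2 * t + 4 * suc k) sum<-rowEnd ⟩
      c * (t * suc t) + 2 * (t * t) + 4 * (suc k * t) + 2 * (g * (t * t)) + 2 * t + 4 * suc k
        ≡⟨ step₃ g c k t ⟩
      (2 * (t * t) + 4 * (suc k * t) + 2 * suc k) + (c * (t * suc t) + 2 * (g * (t * t)) + 2 * t + 2 * suc k)
        -- The row starts depend on ⌊t/5⌋ in the same way as the row ends, so that k disappears from
        -- the difference.
        ≡⟨ cong (_+ (c * (t * suc t) + 2 * (g * (t * t)) + 2 * t + 2 * suc k)) (sum<-starts k r) ⟨
      (2 * Q + 6 * (k * suc k) + t * suc t + 2) + (c * (t * suc t) + 2 * (g * (t * t)) + 2 * t + 2 * suc k)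
        ≡⟨ step₄ g c Q k t ⟩
      2 * (g * (t * t)) + suc c * (t * suc t) + 2 + (2 * Q + 6 * (k * suc k) + 2 * t + 2 * suc k) ∎)
      where
      open ≡-Reasoning
      L = sum< N rowLength
      Q = sum< N rowStart
      H = sum< N (rowEnd t)
      step₁ : ∀ L Q k t → 2 * L + (2 * Q + 6 * (k * suc k) + 2 * t + 2 * suc k)
        ≡ 2 * (Q + L) + 6 * (k * suc k) + 2 * t + 2 * suc k
      step₁ = solve-∀
      step₂ : ∀ H k t → 2 * ((t + suc k) * 1 + H) + 6 * (k * suc k) + 2 * t + 2 * suc k
        ≡ (2 * H + 6 * (k * suc k) + 2 * t) + 2 * t + 4 * suc k
      step₂ = solve-∀
      step₃ : ∀ g c k t → c * (t * suc t) + 2 * (t * t) + 4 * (suc k * t) + 2 * (g * (t * t)) + 2 * t + 4 * suc k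
        ≡ (2 * (t * t) + 4 * (suc k * t) + 2 * suc k) + (c * (t * suc t) + 2 * (g * (t * t)) + 2 * t + 2 * suc k)
      step₃ = solve-∀
      step₄ : ∀ g c Q k t → (2 * Q + 6 * (k * suc k) + t * suc t + 2) + (c * (t * suc t) + 2 * (g * (t * t)) + 2 * t + 2 * suc k)
        ≡ 2 * (g * (t * t)) + suc c * (t * suc t) + 2 + (2 * Q + 6 * (k * suc k) + 2 * t + 2 * suc k)
      step₄ = solve-∀
      total : Q + L ≡ N * 1 + H
      total = trans (sym (sum<-+ N rowStart rowLength)) (trans (sum<-cong N (rowStart+rowLength))
        (trans (sum<-+ N (λ _ → 1) (rowEnd t)) (cong (_+ H) (sum<-const N 1))))

-- Polygons with b ≥ 2

-- slack i j is the amount by which vertex j satisfies side i; ι selects the vertices that are kept.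
module _ {v} (X Y : Fin v → ℕ) (d : ℕ) {{_ : NonZero d}} (sides : Fin v → HalfPlane) (slack : Fin v → Fin v → ℕ)
  (slack-correct : ∀ i j → ⟦ HalfPlane.lhs (sides i) ⟧ (X j) (Y j) d + slack i j ≡ ⟦ HalfPlane.rhs (sides i) ⟧ (X j) (Y j) d)
  where
  open HalfPlane

  selection : ∀ k (2≤k : 2 ≤ k) (ι : Fin (suc k) → Fin v) (step : Fin (suc k) → ℕ) →
    (∀ i → NonZero (step i)) →
    (∀ i → X (ι (next i)) + step i * Form.β (lhs (sides (ι i))) ≡ X (ι i) + step i * Form.β (rhs (sides (ι i)))) →
    (∀ i → Y (ι (next i)) + step i * Form.α (rhs (sides (ι i))) ≡ Y (ι i) + step i * Form.α (lhs (sides (ι i)))) →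
    (∀ i → slack (ι i) (ι i) ≡ 0) →
    True (all? λ i → all? λ j → ¬? (j ≟ᶠ i) →-dec ¬? (j ≟ᶠ next i) →-dec (0 <? slack (ι i) (ι j))) →
    Outline
  selection k 2≤k ι step step≢0 forward-x forward-y diagonal positive = record
    { k = k ; 2≤k = 2≤k ; d = d ; X = X ∘ ι ; Y = Y ∘ ι ; step = step ; side = sides ∘ ι ; step≢0 = step≢0
    ; forward-x = forward-x ; forward-y = forward-y
    ; on-side = λ i → trans (sym (+-identityʳ _))
        (subst (λ e → ⟦ lhs (sides (ι i)) ⟧ (X (ι i)) (Y (ι i)) d + e ≡ _) (diagonal i) (slack-correct (ι i) (ι i)))
    ; inside = λ i j j≢i j≢next → subst (⟦ lhs (sides (ι i)) ⟧ (X (ι j)) (Y (ι j)) d <_) (slack-correct (ι i) (ι j))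
        (m<m+n _ (toWitness positive i j j≢i j≢next))
    }

module Wide (g e δ : ℕ) (δ+c : δ + suc e ≡ 8 + 5 * g) where

  private
    c : ℕ
    c = suc e

  -- The coefficients are written so that neighbouring sides coincide by computation in the
  -- degenerate cases: `1F` and `2F` for g = 0, `2F` and `3F` for δ = 0. This is why `3F` carries δ
  -- + c instead of 8 + 5g.
  sides : Fin 5 → HalfPlane
  sides 0F = 0 ∙x+ 0 ∙y+ 0 ∙t       ≼ 0 ∙x+ 1 ∙y+ 0 ∙t
  sides 1F = 1 ∙x+ c ∙y+ 0 ∙t       ≼ 0 ∙x+ 2 + 5 * g ∙y+ c ∙t
  sides 2F = 1 ∙x+ c ∙y+ 0 ∙t       ≼ 0 ∙x+ 2 ∙y+ g + c ∙t
  sides 3F = 1 ∙x+ δ + c ∙y+ 0 ∙t   ≼ 0 ∙x+ 2 ∙y+ g + (δ + c) ∙t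
  sides 4F = 0 ∙x+ 1 ∙y+ 2 ∙t       ≼ 4 ∙x+ 0 ∙y+ 0 ∙t

  -- In tenths: (1/2, 0) and (c, 0), the bends at heights 1/5 and 1, the latter at the lattice point
  -- (2 + g, 1), and the apex (4/5, 6/5) of the base triangle.
  X Y : Fin 5 → ℕ
  X 0F = 5
  X 1F = 10 * c
  X 2F = 8 * c + 4 + 10 * g
  X 3F = 20 + 10 * g
  X 4F = 8
  Y 0F = 0
  Y 1F = 0
  Y 2F = 2
  Y 3F = 10
  Y 4F = 12

  slack : Fin 5 → Fin 5 → ℕ
  slack 0F 0F = 0
  slack 0F 1F = 0
  slack 0F 2F = 2
  slack 0F 3F = 10
  slack 0F 4F = 12
  slack 1F 0F = 5 + 10 * e
  slack 1F 1F = 0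
  slack 1F 2F = 0
  slack 1F 3F = 40 * g
  slack 1F 4F = 2 * δ + 50 * g
  slack 2F 0F = 5 + 10 * e + 10 * g
  slack 2F 1F = 10 * g
  slack 2F 2F = 0
  slack 2F 3F = 0
  slack 2F 4F = 2 * δ
  slack 3F 0F = 5 + 10 * e + 10 * g + 10 * δ
  slack 3F 1F = 10 * δ + 10 * g
  slack 3F 2F = 8 * δ
  slack 3F 3F = 0
  slack 3F 4F = 0
  slack 4F 0F = 0
  slack 4F 1F = 20 + 40 * e
  slack 4F 2F = 26 + 32 * e + 40 * g
  slack 4F 3F = 50 + 40 * g
  slack 4F 4F = 0

  -- The apex lies two tenths above height 1, so the relation for δ + c enters its equations with
  -- the factor 2.
  by-δ+c : ∀ a b → a + 2 * (8 + 5 * g) ≡ b + 2 * (δ + c) → a ≡ b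
  by-δ+c a b eq = +-cancelʳ-≡ (2 * (δ + c)) a b (trans (cong (λ w → a + 2 * w) δ+c) eq)

  slack-correct : ∀ i j →
    ⟦ HalfPlane.lhs (sides i) ⟧ (X j) (Y j) 10 + slack i j ≡ ⟦ HalfPlane.rhs (sides i) ⟧ (X j) (Y j) 10
  slack-correct 0F 0F = refl
  slack-correct 0F 1F = refl
  slack-correct 0F 2F = refl
  slack-correct 0F 3F = refl
  slack-correct 0F 4F = refl
  slack-correct 1F 0F = identity g e
    where
    identity : ∀ g e → 1 * 5 + suc e * 0 + 0 * 10 + (5 + 10 * e) ≡ 0 * 5 + (2 + 5 * g) * 0 + suc e * 10
    identity = solve-∀
  slack-correct 1F 1F = identity g c
    where
    identity : ∀ g c → 1 * (10 * c) + c * 0 + 0 * 10 + 0 ≡ 0 * (10 * c) + (2 + 5 * g) * 0 + c * 10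
    identity = solve-∀
  slack-correct 1F 2F = identity g c
    where
    identity : ∀ g c → 1 * (8 * c + 4 + 10 * g) + c * 2 + 0 * 10 + 0 ≡ 0 * (8 * c + 4 + 10 * g) + (2 + 5 * g) * 2 + c * 10
    identity = solve-∀
  slack-correct 1F 3F = identity g c
    where
    identity : ∀ g c → 1 * (20 + 10 * g) + c * 10 + 0 * 10 + 40 * g ≡ 0 * (20 + 10 * g) + (2 + 5 * g) * 10 + c * 10
    identity = solve-∀
  slack-correct 1F 4F = by-δ+c _ _ (identity g c δ)
    where
    identity : ∀ g c δ → 1 * 8 + c * 12 + 0 * 10 + (2 * δ + 50 * g) + 2 * (8 + 5 * g)
      ≡ 0 * 8 + (2 + 5 * g) * 12 + c * 10 + 2 * (δ + c)
    identity = solve-∀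
  slack-correct 2F 0F = identity g e
    where
    identity : ∀ g e → 1 * 5 + suc e * 0 + 0 * 10 + (5 + 10 * e + 10 * g) ≡ 0 * 5 + 2 * 0 + (g + suc e) * 10
    identity = solve-∀
  slack-correct 2F 1F = identity g c
    where
    identity : ∀ g c → 1 * (10 * c) + c * 0 + 0 * 10 + 10 * g ≡ 0 * (10 * c) + 2 * 0 + (g + c) * 10
    identity = solve-∀
  slack-correct 2F 2F = identity g c
    where
    identity : ∀ g c → 1 * (8 * c + 4 + 10 * g) + c * 2 + 0 * 10 + 0 ≡ 0 * (8 * c + 4 + 10 * g) + 2 * 2 + (g + c) * 10
    identity = solve-∀
  slack-correct 2F 3F = identity g c
    where
    identity : ∀ g c → 1 * (20 + 10 * g) + c * 10 + 0 * 10 + 0 ≡ 0 * (20 + 10 * g) + 2 * 10 + (g + c) * 10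
    identity = solve-∀
  slack-correct 2F 4F = by-δ+c _ _ (identity g c δ)
    where
    identity : ∀ g c δ → 1 * 8 + c * 12 + 0 * 10 + 2 * δ + 2 * (8 + 5 * g) ≡ 0 * 8 + 2 * 12 + (g + c) * 10 + 2 * (δ + c)
    identity = solve-∀
  slack-correct 3F 0F = identity g e δ
    where
    identity : ∀ g e δ → 1 * 5 + (δ + suc e) * 0 + 0 * 10 + (5 + 10 * e + 10 * g + 10 * δ)
      ≡ 0 * 5 + 2 * 0 + (g + (δ + suc e)) * 10
    identity = solve-∀
  slack-correct 3F 1F = identity g c δ
    where
    identity : ∀ g c δ → 1 * (10 * c) + (δ + c) * 0 + 0 * 10 + (10 * δ + 10 * g) ≡ 0 * (10 * c) + 2 * 0 + (g + (δ + c)) * 10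
    identity = solve-∀
  slack-correct 3F 2F = identity g c δ
    where
    identity : ∀ g c δ → 1 * (8 * c + 4 + 10 * g) + (δ + c) * 2 + 0 * 10 + 8 * δ
      ≡ 0 * (8 * c + 4 + 10 * g) + 2 * 2 + (g + (δ + c)) * 10
    identity = solve-∀
  slack-correct 3F 3F = identity g (δ + c)
    where
    identity : ∀ g c → 1 * (20 + 10 * g) + c * 10 + 0 * 10 + 0 ≡ 0 * (20 + 10 * g) + 2 * 10 + (g + c) * 10
    identity = solve-∀
  slack-correct 3F 4F = by-δ+c _ _ (identity g (δ + c))
    where
    identity : ∀ g c → 1 * 8 + c * 12 + 0 * 10 + 0 + 2 * (8 + 5 * g) ≡ 0 * 8 + 2 * 12 + (g + c) * 10 + 2 * c
    identity = solve-∀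
  slack-correct 4F 0F = refl
  slack-correct 4F 1F = identity e
    where
    identity : ∀ e → 0 * (10 * suc e) + 1 * 0 + 2 * 10 + (20 + 40 * e) ≡ 4 * (10 * suc e) + 0 * 0 + 0 * 10
    identity = solve-∀
  slack-correct 4F 2F = identity g e
    where
    identity : ∀ g e → 0 * (8 * suc e + 4 + 10 * g) + 1 * 2 + 2 * 10 + (26 + 32 * e + 40 * g)
      ≡ 4 * (8 * suc e + 4 + 10 * g) + 0 * 2 + 0 * 10
    identity = solve-∀
  slack-correct 4F 3F = identity g
    where
    identity : ∀ g → 0 * (20 + 10 * g) + 1 * 10 + 2 * 10 + (50 + 40 * g) ≡ 4 * (20 + 10 * g) + 0 * 10 + 0 * 10
    identity = solve-∀
  slack-correct 4F 4F = refl

  forward-01 : 10 * c + (5 + 10 * e) * 0 ≡ 5 + (5 + 10 * e) * 1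
  forward-01 = identity e
    where
    identity : ∀ e → 10 * suc e + (5 + 10 * e) * 0 ≡ 5 + (5 + 10 * e) * 1
    identity = solve-∀

-- The bend at 1/5 disappears with g and the bend at 1 with δ, while vertices must be strictly
-- convex; hence four cases. The right sides have x-coefficient 1, so their steps are their rises in
-- tenths; the left side descends 12 with coefficient 4, and the bottom edge has length 10c - 5.
wide : ∀ g e δ (eq : δ + suc e ≡ 8 + 5 * g) → Realisation (Wide.sides g e δ eq)
wide zero e zero eq = record
  { outline = selection X Y 10 sides slack slack-correct 2 (s≤s (s≤s z≤n))
      (lookup (0F ∷ 1F ∷ 4F ∷ []))
      (lookup (5 + 10 * e ∷ 12 ∷ 3 ∷ []))
      (λ { 0F → _ ; 1F → _ ; 2F → _ })
      (λ { 0F → forward-01 ; 1F → subst (λ w → 8 + 12 * w ≡ 10 * w + 12 * 2) (sym eq) refl ; 2F → refl })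
      (λ { 0F → refl ; 1F → refl ; 2F → refl })
      (λ { 0F → refl ; 1F → refl ; 2F → refl })
      tt
  ; sides⇔ = λ Q → mk⇔ (λ q → λ { 0F → q 0F ; 1F → q 1F ; 2F → q 1F ; 3F → q 1F ; 4F → q 2F })
                        (λ q → λ { 0F → q 0F ; 1F → q 1F ; 2F → q 4F })
  }
  where open Wide zero e zero eq
wide zero e δ@(suc _) eq = record
  { outline = selection X Y 10 sides slack slack-correct 3 (s≤s (s≤s z≤n))
      (lookup (0F ∷ 1F ∷ 3F ∷ 4F ∷ []))
      (lookup (5 + 10 * e ∷ 10 ∷ 2 ∷ 3 ∷ []))
      (λ { 0F → _ ; 1F → _ ; 2F → _ ; 3F → _ })
      (λ { 0F → forward-01 ; 1F → +-comm 20 (10 * suc e)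
         ; 2F → subst (λ w → 8 + 2 * w ≡ 20 + 2 * 2) (sym eq) refl ; 3F → refl })
      (λ { 0F → refl ; 1F → refl ; 2F → refl ; 3F → refl })
      (λ { 0F → refl ; 1F → refl ; 2F → refl ; 3F → refl })
      tt
  ; sides⇔ = λ Q → mk⇔ (λ q → λ { 0F → q 0F ; 1F → q 1F ; 2F → q 1F ; 3F → q 2F ; 4F → q 3F })
                        (λ q → λ { 0F → q 0F ; 1F → q 1F ; 2F → q 3F ; 3F → q 4F })
  }
  where open Wide zero e δ eq
wide g@(suc _) e zero eq = record
  { outline = selection X Y 10 sides slack slack-correct 3 (s≤s (s≤s z≤n))
      (lookup (0F ∷ 1F ∷ 2F ∷ 4F ∷ []))
      (lookup (5 + 10 * e ∷ 2 ∷ 10 ∷ 3 ∷ []))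
      (λ { 0F → _ ; 1F → _ ; 2F → _ ; 3F → _ })
      (λ { 0F → forward-01 ; 1F → identity₁ g e
         ; 2F → by-δ+c _ _ (identity₂ g e) ; 3F → refl })
      (λ { 0F → refl ; 1F → refl ; 2F → refl ; 3F → refl })
      (λ { 0F → refl ; 1F → refl ; 2F → refl ; 3F → refl })
      tt
  ; sides⇔ = λ Q → mk⇔ (λ q → λ { 0F → q 0F ; 1F → q 1F ; 2F → q 2F ; 3F → q 2F ; 4F → q 3F })
                        (λ q → λ { 0F → q 0F ; 1F → q 1F ; 2F → q 2F ; 3F → q 4F })
  }
  where
  open Wide g e zero eq
  identity₁ : ∀ g e → 8 * suc e + 4 + 10 * g + 2 * suc e ≡ 10 * suc e + 2 * (2 + 5 * g)
  identity₁ = solve-∀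
  identity₂ : ∀ g e → 8 + 10 * suc e + 2 * (8 + 5 * g) ≡ 8 * suc e + 4 + 10 * g + 10 * 2 + 2 * suc e
  identity₂ = solve-∀
wide g@(suc _) e δ@(suc _) eq = record
  { outline = selection X Y 10 sides slack slack-correct 4 (s≤s (s≤s z≤n))
      (λ i → i)
      (lookup (5 + 10 * e ∷ 2 ∷ 8 ∷ 2 ∷ 3 ∷ []))
      (λ { 0F → _ ; 1F → _ ; 2F → _ ; 3F → _ ; 4F → _ })
      (λ { 0F → forward-01 ; 1F → identity₁ g e ; 2F → identity₂ g e
         ; 3F → subst (λ w → 8 + 2 * w ≡ 20 + 10 * g + 2 * 2) (sym eq) (identity₃ g) ; 4F → refl })
      (λ { 0F → refl ; 1F → refl ; 2F → refl ; 3F → refl ; 4F → refl })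
      (λ { 0F → refl ; 1F → refl ; 2F → refl ; 3F → refl ; 4F → refl })
      tt
  ; sides⇔ = λ Q → mk⇔ (λ q → q) (λ q → q)
  }
  where
  open Wide g e δ eq
  identity₁ : ∀ g e → 8 * suc e + 4 + 10 * g + 2 * suc e ≡ 10 * suc e + 2 * (2 + 5 * g)
  identity₁ = solve-∀
  identity₂ : ∀ g e → 20 + 10 * g + 8 * suc e ≡ 8 * suc e + 4 + 10 * g + 8 * 2
  identity₂ = solve-∀
  identity₃ : ∀ g → 8 + 2 * (8 + 5 * g) ≡ 20 + 10 * g + 2 * 2
  identity₃ = solve-∀

-- Lattice point counts for b ≥ 2

module WideCount (g e δ : ℕ) (δ+c : δ + suc e ≡ 8 + 5 * g) where

  private
    c : ℕ
    c = suc e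

  open Wide g e δ δ+c using (sides)
  open WideRows g c

  private
    c≤ : c ≤ 8 + 5 * g
    c≤ = subst (c ≤_) δ+c (m≤n+m c δ)

    natural : ∀ t z → Satisfies sides t z → ∃[ m ] ∃[ n ] z ≡ (+ m , + n)
    natural t (x , y) h with n , refl ← 0≤∙y⇒nonNegative x y (+ t) (h 0F)
                        with m , refl ← ≤∙x⇒nonNegative 3 1 2 x n t (h 4F) = m , n , refl

    module _ {t m n : ℕ} (h : Satisfies sides t (+ m , + n)) where
      lower : m + c * n ≤ (2 + 5 * g) * n + c * t
      lower = ≤-certificate 0 (Satisfies⇒ℕ sides h 1F) (identity g c m n t)
        where
        identity : ∀ g c m n t → m + c * n + (0 * m + (2 + 5 * g) * n + c * t) + 0
          ≡ (2 + 5 * g) * n + c * t + (1 * m + c * n + 0 * t)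
        identity = solve-∀
      middle : m + c * n ≤ 2 * n + (c + g) * t
      middle = ≤-certificate 0 (Satisfies⇒ℕ sides h 2F) (identity g c m n t)
        where
        identity : ∀ g c m n t → m + c * n + (0 * m + 2 * n + (g + c) * t) + 0
          ≡ 2 * n + (c + g) * t + (1 * m + c * n + 0 * t)
        identity = solve-∀
      upper : m + (6 + 5 * g) * n ≤ (8 + 6 * g) * t
      upper = ≤-certificate 0 (subst (λ w → 1 * m + w * n + 0 * t ≤ 0 * m + 2 * n + (g + w) * t) δ+c (Satisfies⇒ℕ sides h 3F))
        (identity g m n t)
        where
        identity : ∀ g m n t → m + (6 + 5 * g) * n + (0 * m + 2 * n + (g + (8 + 5 * g)) * t) + 0
          ≡ (8 + 6 * g) * t + (1 * m + (8 + 5 * g) * n + 0 * t)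
        identity = solve-∀
      left : n + 2 * t ≤ 4 * m
      left = ≤-certificate 0 (Satisfies⇒ℕ sides h 4F) (identity m n t)
        where
        identity : ∀ m n t → n + 2 * t + (4 * m + 0 * n + 0 * t) + 0 ≡ 4 * m + (0 * m + 1 * n + 2 * t)
        identity = solve-∀
      height : 5 * n ≤ 6 * t
      height = 5n≤6t t m n upper left

    satisfies : ∀ {t m n} → m + c * n ≤ (2 + 5 * g) * n + c * t → m + c * n ≤ 2 * n + (c + g) * t →
      m + (6 + 5 * g) * n ≤ (8 + 6 * g) * t → n + 2 * t ≤ 4 * m → Satisfies sides t (+ m , + n)
    satisfies {t} {m} {n} lower middle upper left = ℕ⇒Satisfies sides λ
      { 0F → z≤n
      ; 1F → ≤-certificate 0 lower (identity₁ g c m n t)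
      ; 2F → ≤-certificate 0 middle (identity₂ g c m n t)
      ; 3F → subst (λ w → 1 * m + w * n + 0 * t ≤ 0 * m + 2 * n + (g + w) * t) (sym δ+c)
               (≤-certificate 0 upper (identity₃ g m n t))
      ; 4F → ≤-certificate 0 left (identity₄ m n t) }
      where
      identity₁ : ∀ g c m n t → 1 * m + c * n + 0 * t + ((2 + 5 * g) * n + c * t) + 0
        ≡ 0 * m + (2 + 5 * g) * n + c * t + (m + c * n)
      identity₁ = solve-∀
      identity₂ : ∀ g c m n t → 1 * m + c * n + 0 * t + (2 * n + (c + g) * t) + 0
        ≡ 0 * m + 2 * n + (g + c) * t + (m + c * n)
      identity₂ = solve-∀
      identity₃ : ∀ g m n t → 1 * m + (8 + 5 * g) * n + 0 * t + ((8 + 6 * g) * t) + 0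
        ≡ 0 * m + 2 * n + (g + (8 + 5 * g)) * t + (m + (6 + 5 * g) * n)
      identity₃ = solve-∀
      identity₄ : ∀ m n t → 0 * m + 1 * n + 2 * t + 4 * m + 0 ≡ 4 * m + 0 * n + 0 * t + (n + 2 * t)
      identity₄ = solve-∀

  count : ∀ t → ∃[ N ] HasCard (Satisfies sides t) N × 2 * N ≡ 2 * (g * (t * t)) + suc c * (t * suc t) + 2
  count t with result k r refl ← t divMod 5 =
    _ , rows-HasCard (rowStart k r) (rowLength k r) (t′ + suc k) _ to from , sum<-rowLength k r
    where
    t′ = toℕ r + k * 5
    to : ∀ z → Satisfies sides t′ z → ∃[ m ] ∃[ n ] z ≡ (+ m , + n) × n < t′ + suc k ×
      rowStart k r n ≤ m × m < rowStart k r n + rowLength k r n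
    to z h with m , n , refl ← natural t′ z h = m , n , refl , n<N ,
      n≤m*d⇒n⌈/⌉d≤m (2 * t′ + n) m 4 (subst₂ _≤_ (+-comm n (2 * t′)) (*-comm 4 m) (left h)) ,
      subst (m <_) (sym (rowStart+rowLength k r n n<N))
        (s≤s (≤rowEnd c≤ t′ m n (height h) (lower h) (middle h) (upper h)))
      where n<N = 5n≤6t⇒n<N k r n (height h)
    from : ∀ m n → n < t′ + suc k → rowStart k r n ≤ m → m < rowStart k r n + rowLength k r n →
      Satisfies sides t′ (+ m , + n)
    from m n n<N s≤m m<e =
      let lower , middle , upper = ≤rowEnd⁻¹ c≤ t′ m n (n<N⇒5n≤6t k r n n<N)
            (s≤s⁻¹ (subst (m <_) (rowStart+rowLength k r n n<N) m<e))
      in satisfies lower middle upper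
        (subst₂ _≤_ (+-comm (2 * t′) n) (*-comm m 4) (n⌈/⌉d≤m⇒n≤m*d (2 * t′ + n) m 4 s≤m))

  private
    row≤1 : ∀ n → 5 * n ≤ 6 * 1 → n ≡ 0 ⊎ n ≡ 1
    row≤1 0 h = inj₁ refl
    row≤1 1 h = inj₂ refl
    row≤1 (suc (suc n)) h = contradiction (≤-trans (*-monoʳ-≤ 5 (s≤s (s≤s (z≤n {n})))) h) λ where
      (s≤s (s≤s (s≤s (s≤s (s≤s (s≤s ()))))))

    1≤ : ∀ n {m} → suc n ≤ 4 * m → 1 ≤ m
    1≤ n {suc m} h = s≤s z≤n

    -- Row 1 of the polygon spans 3/4 ≤ x ≤ 2 + g. Its right end is a lattice point on the boundary,
    -- and the g + 1 lattice points before it are interior.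
    strict-row1 : ∀ {m} → 1 ≤ m → m < 2 + g → StrictlySatisfies sides 1 (+ m , + 1)
    strict-row1 {m} 1≤m m<2+g = ℕ⇒StrictlySatisfies sides λ
      { 0F → s≤s z≤n
      ; 1F → ≤-certificate (4 * g) m<2+g (identity₁ g c m)
      ; 2F → ≤-certificate 0 m<2+g (identity₂ g c m)
      ; 3F → ≤-certificate 0 m<2+g (identity₂ g (δ + c) m)
      ; 4F → ≤-certificate 0 (*-monoʳ-≤ 4 1≤m) (identity₃ m) }
      where
      identity₁ : ∀ g c m → suc (1 * m + c * 1 + 0 * 1) + (2 + g) + 4 * g ≡ 0 * m + (2 + 5 * g) * 1 + c * 1 + suc m
      identity₁ = solve-∀
      identity₂ : ∀ g c m → suc (1 * m + c * 1 + 0 * 1) + (2 + g) + 0 ≡ 0 * m + 2 * 1 + (g + c) * 1 + suc m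
      identity₂ = solve-∀
      identity₃ : ∀ m → suc (0 * m + 1 * 1 + 2 * 1) + 4 * m + 0 ≡ 4 * m + 0 * 1 + 0 * 1 + 4 * 1
      identity₃ = solve-∀

  interior : HasCard (StrictlySatisfies sides 1) (suc g)
  interior = rows-HasCard (λ _ → 1) len 2 _ to from
    where
    len : ℕ → ℕ
    len 0       = 0
    len (suc _) = suc g
    place : ∀ m n → StrictlySatisfies sides 1 (+ m , + n) → n ≡ 0 ⊎ n ≡ 1 → n < 2 × 1 ≤ m × m < 1 + len n
    place m .0 h (inj₁ refl) = contradiction (StrictlySatisfies⇒ℕ sides h 0F) λ ()
    place m .1 h (inj₂ refl) = s≤s (s≤s z≤n) , 1≤ 2 (left (StrictlySatisfies⇒Satisfies sides h)) ,
      ≤-certificate 0 (StrictlySatisfies⇒ℕ sides h 2F) (identity g c m)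
      where
      identity : ∀ g c m → suc m + (0 * m + 2 * 1 + (g + c) * 1) + 0 ≡ 2 + g + suc (1 * m + c * 1 + 0 * 1)
      identity = solve-∀
    to : ∀ z → StrictlySatisfies sides 1 z → ∃[ m ] ∃[ n ] z ≡ (+ m , + n) × n < 2 × 1 ≤ m × m < 1 + len n
    to z h with m , n , refl ← natural 1 z (StrictlySatisfies⇒Satisfies sides h) =
      m , n , refl , place m n h (row≤1 n (height (StrictlySatisfies⇒Satisfies sides h)))
    from : ∀ m n → n < 2 → 1 ≤ m → m < 1 + len n → StrictlySatisfies sides 1 (+ m , + n)
    from m 0 _ 1≤m m<1 = contradiction m<1 (≤⇒≯ 1≤m)
    from m 1 _ 1≤m m<  = strict-row1 1≤m m<
    from m (suc (suc n)) (s≤s (s≤s ()))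

  -- The bottom edge from 1/2 to c contributes c points, the right end of row 1 one more; row 2 is
  -- already above the apex.
  boundary : HasCard (λ z → Satisfies sides 1 z × ¬ StrictlySatisfies sides 1 z) (suc c)
  boundary = subst (HasCard _) (+-comm c 1) (rows-HasCard start len 2 _ to from)
    where
    start len : ℕ → ℕ
    start 0       = 1
    start (suc _) = 2 + g
    len 0       = c
    len (suc _) = 1
    place : ∀ m n → Satisfies sides 1 (+ m , + n) → ¬ StrictlySatisfies sides 1 (+ m , + n) → n ≡ 0 ⊎ n ≡ 1 →
      n < 2 × start n ≤ m × m < start n + len n
    place m .0 h ¬strict (inj₁ refl) = s≤s z≤n , 1≤ 1 (left h) , s≤s (≤-certificate 0 (lower h) (identity g c m))
      where
      identity : ∀ g c m → m + ((2 + 5 * g) * 0 + c * 1) + 0 ≡ c + (m + c * 0)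
      identity = solve-∀
    place m .1 h ¬strict (inj₂ refl) = s≤s (s≤s z≤n) , ≮⇒≥ (¬strict ∘ strict-row1 (1≤ 2 (left h))) ,
      ≤-certificate 0 (middle h) (identity g c m)
      where
      identity : ∀ g c m → suc m + (2 * 1 + (c + g) * 1) + 0 ≡ 2 + g + 1 + (m + c * 1)
      identity = solve-∀
    to : ∀ z → Satisfies sides 1 z × ¬ StrictlySatisfies sides 1 z →
      ∃[ m ] ∃[ n ] z ≡ (+ m , + n) × n < 2 × start n ≤ m × m < start n + len n
    to z (h , ¬strict) with m , n , refl ← natural 1 z h = m , n , refl , place m n h ¬strict (row≤1 n (height h))
    from : ∀ m n → n < 2 → start n ≤ m → m < start n + len n →
      Satisfies sides 1 (+ m , + n) × ¬ StrictlySatisfies sides 1 (+ m , + n)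
    from m 0 _ 1≤m m<1+c =
      satisfies (≤-certificate 0 m<1+c (identity₁ g c m)) (≤-certificate g m<1+c (identity₂ g c m))
        (≤-certificate g (≤-trans m<1+c (s≤s c≤)) (identity₃ g m)) (≤-certificate 2 (*-monoʳ-≤ 4 1≤m) (identity₄ m)) ,
      λ h → contradiction (StrictlySatisfies⇒ℕ sides h 0F) λ ()
      where
      identity₁ : ∀ g c m → m + c * 0 + (1 + c) + 0 ≡ (2 + 5 * g) * 0 + c * 1 + suc m
      identity₁ = solve-∀
      identity₂ : ∀ g c m → m + c * 0 + (1 + c) + g ≡ 2 * 0 + (c + g) * 1 + suc m
      identity₂ = solve-∀
      identity₃ : ∀ g m → m + (6 + 5 * g) * 0 + suc (8 + 5 * g) + g ≡ (8 + 6 * g) * 1 + suc m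
      identity₃ = solve-∀
      identity₄ : ∀ m → 0 + 2 * 1 + 4 * m + 2 ≡ 4 * m + 4 * 1
      identity₄ = solve-∀
    from m 1 _ 2+g≤m m<3+g with refl ← ≤-antisym 2+g≤m (s≤s⁻¹ (subst (m <_) (+-comm (2 + g) 1) m<3+g)) =
      satisfies (≤-slack (4 * g) (identity₁ g c)) (≤-slack 0 (identity₂ g c)) (≤-slack 0 (identity₃ g))
        (≤-slack (5 + 4 * g) (identity₄ g)) ,
      -- The point (2 + g, 1) attains equality in side `2F` for every c.
      λ h → <-irrefl (identity₅ g c) (StrictlySatisfies⇒ℕ sides h 2F)
      where
      identity₁ : ∀ g c → 2 + g + c * 1 + 4 * g ≡ (2 + 5 * g) * 1 + c * 1
      identity₁ = solve-∀
      identity₂ : ∀ g c → 2 + g + c * 1 + 0 ≡ 2 * 1 + (c + g) * 1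
      identity₂ = solve-∀
      identity₃ : ∀ g → 2 + g + (6 + 5 * g) * 1 + 0 ≡ (8 + 6 * g) * 1
      identity₃ = solve-∀
      identity₄ : ∀ g → 1 + 2 * 1 + (5 + 4 * g) ≡ 4 * (2 + g)
      identity₄ = solve-∀
      identity₅ : ∀ g c → 1 * (2 + g) + c * 1 + 0 * 1 ≡ 0 * (2 + g) + 2 * 1 + (g + c) * 1
      identity₅ = solve-∀
    from m (suc (suc n)) (s≤s (s≤s ()))

-- Polygons with b = 1

module Narrow (g : ℕ) where

  sides : Fin 4 → HalfPlane
  sides 0F = 0 ∙x+ 0 ∙y+ 0 ∙t       ≼ 0 ∙x+ 1 ∙y+ 0 ∙t
  sides 1F = 8 ∙x+ 0 ∙y+ 0 ∙t       ≼ 0 ∙x+ 1 + 8 * g ∙y+ 8 ∙t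
  sides 2F = 8 ∙x+ 8 * g ∙y+ 0 ∙t   ≼ 0 ∙x+ 1 ∙y+ 8 + 16 * g ∙t
  sides 3F = 0 ∙x+ 3 ∙y+ 4 ∙t       ≼ 8 ∙x+ 0 ∙y+ 0 ∙t

  -- In eighths: (1/2, 0), (1, 0), (g + 9/8, 1), (5/4, 2). For g = 0 the third point lies on the
  -- edge of the base triangle, and sides `1F` and `2F` coincide by computation.
  X Y : Fin 4 → ℕ
  X 0F = 4
  X 1F = 8
  X 2F = 9 + 8 * g
  X 3F = 10
  Y 0F = 0
  Y 1F = 0
  Y 2F = 8
  Y 3F = 16

  slack : Fin 4 → Fin 4 → ℕ
  slack 0F 0F = 0
  slack 0F 1F = 0
  slack 0F 2F = 8
  slack 0F 3F = 16
  slack 1F 0F = 32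
  slack 1F 1F = 0
  slack 1F 2F = 0
  slack 1F 3F = 128 * g
  slack 2F 0F = 32 + 128 * g
  slack 2F 1F = 128 * g
  slack 2F 2F = 0
  slack 2F 3F = 0
  slack 3F 0F = 0
  slack 3F 1F = 32
  slack 3F 2F = 16 + 64 * g
  slack 3F 3F = 0

  slack-correct : ∀ i j →
    ⟦ HalfPlane.lhs (sides i) ⟧ (X j) (Y j) 8 + slack i j ≡ ⟦ HalfPlane.rhs (sides i) ⟧ (X j) (Y j) 8
  slack-correct 0F 0F = refl
  slack-correct 0F 1F = refl
  slack-correct 0F 2F = refl
  slack-correct 0F 3F = refl
  slack-correct 1F 0F = identity g
    where
    identity : ∀ g → 8 * 4 + 0 * 0 + 0 * 8 + 32 ≡ 0 * 4 + (1 + 8 * g) * 0 + 8 * 8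
    identity = solve-∀
  slack-correct 1F 1F = identity g
    where
    identity : ∀ g → 8 * 8 + 0 * 0 + 0 * 8 + 0 ≡ 0 * 8 + (1 + 8 * g) * 0 + 8 * 8
    identity = solve-∀
  slack-correct 1F 2F = identity g
    where
    identity : ∀ g → 8 * (9 + 8 * g) + 0 * 8 + 0 * 8 + 0 ≡ 0 * (9 + 8 * g) + (1 + 8 * g) * 8 + 8 * 8
    identity = solve-∀
  slack-correct 1F 3F = identity g
    where
    identity : ∀ g → 8 * 10 + 0 * 16 + 0 * 8 + 128 * g ≡ 0 * 10 + (1 + 8 * g) * 16 + 8 * 8
    identity = solve-∀
  slack-correct 2F 0F = identity g
    where
    identity : ∀ g → 8 * 4 + 8 * g * 0 + 0 * 8 + (32 + 128 * g) ≡ 0 * 4 + 1 * 0 + (8 + 16 * g) * 8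
    identity = solve-∀
  slack-correct 2F 1F = identity g
    where
    identity : ∀ g → 8 * 8 + 8 * g * 0 + 0 * 8 + 128 * g ≡ 0 * 8 + 1 * 0 + (8 + 16 * g) * 8
    identity = solve-∀
  slack-correct 2F 2F = identity g
    where
    identity : ∀ g → 8 * (9 + 8 * g) + 8 * g * 8 + 0 * 8 + 0 ≡ 0 * (9 + 8 * g) + 1 * 8 + (8 + 16 * g) * 8
    identity = solve-∀
  slack-correct 2F 3F = identity g
    where
    identity : ∀ g → 8 * 10 + 8 * g * 16 + 0 * 8 + 0 ≡ 0 * 10 + 1 * 16 + (8 + 16 * g) * 8
    identity = solve-∀
  slack-correct 3F 0F = refl
  slack-correct 3F 1F = refl
  slack-correct 3F 2F = identity g
    where
    identity : ∀ g → 0 * (9 + 8 * g) + 3 * 8 + 4 * 8 + (16 + 64 * g) ≡ 8 * (9 + 8 * g) + 0 * 8 + 0 * 8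
    identity = solve-∀
  slack-correct 3F 3F = refl

narrow : ∀ g → Realisation (Narrow.sides g)
narrow zero = record
  { outline = selection X Y 8 sides slack slack-correct 2 (s≤s (s≤s z≤n))
      (lookup (0F ∷ 1F ∷ 3F ∷ []))
      (lookup (4 ∷ 2 ∷ 2 ∷ []))
      (λ { 0F → _ ; 1F → _ ; 2F → _ })
      (λ { 0F → refl ; 1F → refl ; 2F → refl })
      (λ { 0F → refl ; 1F → refl ; 2F → refl })
      (λ { 0F → refl ; 1F → refl ; 2F → refl })
      tt
  ; sides⇔ = λ Q → mk⇔ (λ q → λ { 0F → q 0F ; 1F → q 1F ; 2F → q 1F ; 3F → q 2F })
                        (λ q → λ { 0F → q 0F ; 1F → q 1F ; 2F → q 3F })
  }
  where open Narrow zero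
narrow g@(suc _) = record
  { outline = selection X Y 8 sides slack slack-correct 3 (s≤s (s≤s z≤n))
      (λ i → i)
      (lookup (4 ∷ 1 ∷ 1 ∷ 2 ∷ []))
      (λ { 0F → _ ; 1F → _ ; 2F → _ ; 3F → _ })
      (λ { 0F → refl ; 1F → identity₁ g ; 2F → identity₂ g ; 3F → refl })
      (λ { 0F → refl ; 1F → refl ; 2F → refl ; 3F → refl })
      (λ { 0F → refl ; 1F → refl ; 2F → refl ; 3F → refl })
      tt
  ; sides⇔ = λ Q → mk⇔ (λ q → q) (λ q → q)
  }
  where
  open Narrow g
  identity₁ : ∀ g → 9 + 8 * g + 1 * 0 ≡ 8 + 1 * (1 + 8 * g)
  identity₁ = solve-∀
  identity₂ : ∀ g → 10 + 1 * (8 * g) ≡ 9 + 8 * g + 1 * 1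
  identity₂ = solve-∀

-- Sums for b = 1

m<suc[m/d]*d : ∀ m d .{{_ : NonZero d}} → m < suc (m / d) * d
m<suc[m/d]*d m d = subst (_< suc (m / d) * d) (sym (m≡m%n+[m/n]*n m d)) (+-monoˡ-< (m / d * d) (m%n<n m d))

-- The two end rows of the tent vanish; without them it is the tent of the preceding t raised by
-- one. Its peak is at the integral row t, so no rounding arises.
sum<-tent : ∀ t → sum< (suc (2 * t)) (λ n → n ⊓ (2 * t ∸ n)) ≡ t * t
sum<-tent zero    = refl
sum<-tent (suc t) = begin
  sum< (suc (2 * suc t)) (λ n → n ⊓ (2 * suc t ∸ n))
    ≡⟨ cong (λ M → sum< (suc M) (λ n → n ⊓ (M ∸ n))) (*-distribˡ-+ 2 1 t) ⟩
  sum< (1 + suc M) f + (2 + M) ⊓ (M ∸ M)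
    ≡⟨ cong₂ _+_ (sum<-split 1 (suc M) f) (cong ((2 + M) ⊓_) (n∸n≡0 M)) ⟩
  sum< (suc M) (λ n → suc n ⊓ (suc M ∸ n)) + 0
    ≡⟨ +-identityʳ _ ⟩
  sum< (suc M) (λ n → suc n ⊓ (suc M ∸ n))
    ≡⟨ sum<-cong (suc M) (λ n n≤M → cong (suc n ⊓_) (+-∸-assoc 1 (s≤s⁻¹ n≤M))) ⟩
  sum< (suc M) (λ n → 1 + n ⊓ (M ∸ n))
    ≡⟨ sum<-+ (suc M) (λ _ → 1) (λ n → n ⊓ (M ∸ n)) ⟩
  sum< (suc M) (λ _ → 1) + sum< (suc M) (λ n → n ⊓ (M ∸ n))
    ≡⟨ cong₂ _+_ (sum<-const (suc M) 1) (sum<-tent t) ⟩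
  suc (2 * t) * 1 + t * t
    ≡⟨ identity t ⟩
  suc t * suc t ∎
  where
  open ≡-Reasoning
  M = 2 * t
  f : ℕ → ℕ
  f n = n ⊓ (2 + M ∸ n)
  identity : ∀ t → suc (2 * t) * 1 + t * t ≡ suc t * suc t
  identity = solve-∀

-- As 3 is invertible modulo 8, the numbers 4t + 3n with n < 8 meet each residue class once, so the
-- total rounding error does not depend on t. Formally, t ↦ t + 2 raises every ceiling by one.
sum<-8-⌈/8⌉ : ∀ t → sum< 8 (λ n → (4 * t + 3 * n) ⌈/⌉ 8) ≡ 14 + 4 * t
sum<-8-⌈/8⌉ zero          = refl
sum<-8-⌈/8⌉ (suc zero)    = refl
sum<-8-⌈/8⌉ (suc (suc t)) = begin
  sum< 8 (λ n → (4 * (2 + t) + 3 * n) ⌈/⌉ 8)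
    ≡⟨ sum<-cong 8 (λ n _ → trans (cong (_⌈/⌉ 8) (shift t n)) ([k*d+m]⌈/⌉d 1 (4 * t + 3 * n) 8)) ⟩
  sum< 8 (λ n → 1 + (4 * t + 3 * n) ⌈/⌉ 8)
    ≡⟨ sum<-+ 8 (λ _ → 1) (λ n → (4 * t + 3 * n) ⌈/⌉ 8) ⟩
  8 + sum< 8 (λ n → (4 * t + 3 * n) ⌈/⌉ 8)
    ≡⟨ cong (λ e → 8 + e) (sum<-8-⌈/8⌉ t) ⟩
  8 + (14 + 4 * t)
    ≡⟨ identity t ⟩
  14 + 4 * suc (suc t) ∎
  where
  open ≡-Reasoning
  shift : ∀ t n → 4 * (2 + t) + 3 * n ≡ 1 * 8 + (4 * t + 3 * n)
  shift = solve-∀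
  identity : ∀ t → 8 + (14 + 4 * t) ≡ 14 + 4 * suc (suc t)
  identity = solve-∀

-- Replacing t by t + 4 and n by n + 8 leaves ⌊n/8⌋ - ⌈(4t + 3n)/8⌉ + t unchanged.
sum<-/8-⌈/8⌉ : ∀ t → 2 * (suc (2 * t) * suc t) + 2 * sum< (suc (2 * t)) (_/ 8)
  ≡ t * suc t + 2 + 2 * sum< (suc (2 * t)) (λ n → (4 * t + 3 * n) ⌈/⌉ 8)
sum<-/8-⌈/8⌉ 0 = refl
sum<-/8-⌈/8⌉ 1 = refl
sum<-/8-⌈/8⌉ 2 = refl
sum<-/8-⌈/8⌉ 3 = refl
sum<-/8-⌈/8⌉ (suc (suc (suc (suc t)))) = begin
  2 * (suc (2 * (4 + t)) * (5 + t)) + 2 * sum< (suc (2 * (4 + t))) (_/ 8)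
    ≡⟨ cong (λ e → 2 * (suc (2 * (4 + t)) * (5 + t)) + 2 * e) floors ⟩
  2 * (suc (2 * (4 + t)) * (5 + t)) + 2 * (suc (2 * t) * 1 + F)
    ≡⟨ step₁ F t ⟩
  2 * (suc (2 * t) * suc t) + 2 * F + (36 * t + 90)
    -- The eight new rows contribute 8 (t + 5) - (30 + 4t) = 4t + 10 points of the base triangle,
    -- exactly the growth of t (t + 1) / 2 from t to t + 4.
    ≡⟨ cong (_+ (36 * t + 90)) (sum<-/8-⌈/8⌉ t) ⟩
  t * suc t + 2 + 2 * G + (36 * t + 90)
    ≡⟨ step₂ G t ⟩
  (4 + t) * (5 + t) + 2 + 2 * (8 * 2 + (14 + 4 * t) + (suc (2 * t) * 5 + G))
    ≡⟨ cong (λ e → (4 + t) * (5 + t) + 2 + 2 * e) ceilings ⟨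
  (4 + t) * (5 + t) + 2 + 2 * sum< (suc (2 * (4 + t))) (λ n → (4 * (4 + t) + 3 * n) ⌈/⌉ 8) ∎
  where
  open ≡-Reasoning
  F = sum< (suc (2 * t)) (_/ 8)
  G = sum< (suc (2 * t)) (λ n → (4 * t + 3 * n) ⌈/⌉ 8)
  length≡ : ∀ t → suc (2 * (4 + t)) ≡ 8 + suc (2 * t)
  length≡ = solve-∀
  step₁ : ∀ F t → 2 * (suc (2 * (4 + t)) * (5 + t)) + 2 * (suc (2 * t) * 1 + F)
    ≡ 2 * (suc (2 * t) * suc t) + 2 * F + (36 * t + 90)
  step₁ = solve-∀
  step₂ : ∀ G t → t * suc t + 2 + 2 * G + (36 * t + 90)
    ≡ (4 + t) * (5 + t) + 2 + 2 * (8 * 2 + (14 + 4 * t) + (suc (2 * t) * 5 + G))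
  step₂ = solve-∀
  floors : sum< (suc (2 * (4 + t))) (_/ 8) ≡ suc (2 * t) * 1 + F
  floors = begin
    sum< (suc (2 * (4 + t))) (_/ 8)               ≡⟨ cong (λ e → sum< e (_/ 8)) (length≡ t) ⟩
    -- The first eight floors are zero by evaluation.
    sum< (8 + suc (2 * t)) (_/ 8)                 ≡⟨ sum<-split 8 (suc (2 * t)) (_/ 8) ⟩
    sum< (suc (2 * t)) (λ n → (8 + n) / 8)        ≡⟨ sum<-cong (suc (2 * t)) (λ n _ → [k*d+m]/d 1 n 8) ⟩
    sum< (suc (2 * t)) (λ n → 1 + n / 8)          ≡⟨ sum<-+ (suc (2 * t)) (λ _ → 1) (_/ 8) ⟩
    sum< (suc (2 * t)) (λ _ → 1) + F              ≡⟨ cong (_+ F) (sum<-const (suc (2 * t)) 1) ⟩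
    suc (2 * t) * 1 + F                           ∎
  ceilings : sum< (suc (2 * (4 + t))) (λ n → (4 * (4 + t) + 3 * n) ⌈/⌉ 8)
    ≡ 8 * 2 + (14 + 4 * t) + (suc (2 * t) * 5 + G)
  ceilings = begin
    sum< (suc (2 * (4 + t))) c
      ≡⟨ cong (λ e → sum< e c) (length≡ t) ⟩
    sum< (8 + suc (2 * t)) c
      ≡⟨ sum<-split 8 (suc (2 * t)) c ⟩
    sum< 8 c + sum< (suc (2 * t)) (λ n → c (8 + n))
      ≡⟨ cong₂ _+_
           (sum<-cong 8 (λ n _ → trans (cong (_⌈/⌉ 8) (shift₁ t n)) ([k*d+m]⌈/⌉d 2 (4 * t + 3 * n) 8)))
           (sum<-cong (suc (2 * t)) (λ n _ → trans (cong (_⌈/⌉ 8) (shift₂ t n)) ([k*d+m]⌈/⌉d 5 (4 * t + 3 * n) 8))) ⟩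
    sum< 8 (λ n → 2 + (4 * t + 3 * n) ⌈/⌉ 8) + sum< (suc (2 * t)) (λ n → 5 + (4 * t + 3 * n) ⌈/⌉ 8)
      ≡⟨ cong₂ _+_ (sum<-+ 8 (λ _ → 2) (λ n → (4 * t + 3 * n) ⌈/⌉ 8))
                   (sum<-+ (suc (2 * t)) (λ _ → 5) (λ n → (4 * t + 3 * n) ⌈/⌉ 8)) ⟩
    8 * 2 + sum< 8 (λ n → (4 * t + 3 * n) ⌈/⌉ 8) + (sum< (suc (2 * t)) (λ _ → 5) + G)
      ≡⟨ cong₂ (λ u v → 8 * 2 + u + (v + G)) (sum<-8-⌈/8⌉ t) (sum<-const (suc (2 * t)) 5) ⟩
    8 * 2 + (14 + 4 * t) + (suc (2 * t) * 5 + G) ∎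
    where
    c : ℕ → ℕ
    c n = (4 * (4 + t) + 3 * n) ⌈/⌉ 8
    shift₁ : ∀ t n → 4 * (4 + t) + 3 * n ≡ 2 * 8 + (4 * t + 3 * n)
    shift₁ = solve-∀
    shift₂ : ∀ t n → 4 * (4 + t) + 3 * (8 + n) ≡ 5 * 8 + (4 * t + 3 * n)
    shift₂ = solve-∀

-- Lattice point counts for b = 1

module NarrowCount (g : ℕ) where
  open Narrow g using (sides)

  module _ (t : ℕ) where
    private
      N : ℕ
      N = suc (2 * t)

    tent rowStart rowEnd rowLength : ℕ → ℕ
    tent n = n ⊓ (2 * t ∸ n)
    rowStart n = (4 * t + 3 * n) ⌈/⌉ 8
    rowEnd n = ((t + g * tent n) * 8 + n) / 8
    rowLength n = suc (rowEnd n) ∸ rowStart n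

    -- Both ends are rounded here, and a row can be empty, as row 2 is for t = 1. Real left end ≤
    -- real right end still puts the ceiling at most one above the floor, which is all that the
    -- subtraction needs.
    rowStart+rowLength : ∀ n → n < N → rowStart n + rowLength n ≡ suc (rowEnd n)
    rowStart+rowLength n n<N = m+[n∸m]≡n (n≤m*d⇒n⌈/⌉d≤m (4 * t + 3 * n) (suc (rowEnd n)) 8
      (≤-trans (≤-certificate (8 * (g * tent n)) (*-monoʳ-≤ 2 (s≤s⁻¹ n<N)) (identity t n (g * tent n)))
               (<⇒≤ (m<suc[m/d]*d ((t + g * tent n) * 8 + n) 8))))
      where
      identity : ∀ t n w → 4 * t + 3 * n + 2 * (2 * t) + 8 * w ≡ (t + w) * 8 + n + 2 * n
      identity = solve-∀

    ≤rowEnd : ∀ m n → n < N → 8 * m ≤ (1 + 8 * g) * n + 8 * t → 8 * m + 8 * g * n ≤ n + (8 + 16 * g) * t → m ≤ rowEnd n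
    ≤rowEnd m n n<N e₁ e₂ = m*d≤n⇒m≤n/d m _ 8 (bound (⊓-sel n (2 * t ∸ n)))
      where
      identity₁ : ∀ g m n t → m * 8 + ((1 + 8 * g) * n + 8 * t) + 0 ≡ (t + g * n) * 8 + n + 8 * m
      identity₁ = solve-∀
      identity₂ : ∀ g m n t v → m * 8 + (n + (8 + 16 * g) * t + 8 * g * (n + v)) + 0
        ≡ (t + g * v) * 8 + n + (8 * m + 8 * g * n + 8 * g * (2 * t))
      identity₂ = solve-∀
      bound : _ → m * 8 ≤ (t + g * tent n) * 8 + n
      bound (inj₁ eq) rewrite eq = ≤-certificate 0 e₁ (identity₁ g m n t)
      bound (inj₂ eq) rewrite eq = ≤-certificate 0
        (+-mono-≤ e₂ (*-monoʳ-≤ (8 * g) (≤-reflexive (sym (m+[n∸m]≡n (s≤s⁻¹ n<N))))))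
        (identity₂ g m n t (2 * t ∸ n))

    ≤rowEnd⁻¹ : ∀ m n → n < N → m ≤ rowEnd n → 8 * m ≤ (1 + 8 * g) * n + 8 * t × 8 * m + 8 * g * n ≤ n + (8 + 16 * g) * t
    ≤rowEnd⁻¹ m n n<N m≤ =
      ≤-certificate 0 (+-mono-≤ bound (*-monoʳ-≤ (8 * g) (m⊓n≤m n (2 * t ∸ n)))) (identity₁ g m n t (tent n)) ,
      ≤-certificate 0 (+-mono-≤ (+-mono-≤ bound (*-monoʳ-≤ (8 * g) (m⊓n≤n n (2 * t ∸ n))))
          (*-monoʳ-≤ (8 * g) (≤-reflexive (m+[n∸m]≡n (s≤s⁻¹ n<N)))))
        (identity₂ g m n t (tent n) (2 * t ∸ n))
      where
      bound : m * 8 ≤ (t + g * tent n) * 8 + n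
      bound = m≤n/d⇒m*d≤n m _ 8 m≤
      identity₁ : ∀ g m n t w → 8 * m + ((t + g * w) * 8 + n + 8 * g * n) + 0
        ≡ (1 + 8 * g) * n + 8 * t + (m * 8 + 8 * g * w)
      identity₁ = solve-∀
      identity₂ : ∀ g m n t w v → 8 * m + 8 * g * n + ((t + g * w) * 8 + n + 8 * g * v + 8 * g * (2 * t)) + 0
        ≡ n + (8 + 16 * g) * t + (m * 8 + 8 * g * w + 8 * g * (n + v))
      identity₂ = solve-∀

    sum<-rowLength : 2 * sum< N rowLength ≡ 2 * (g * (t * t)) + 1 * (t * suc t) + 2
    sum<-rowLength = +-cancelʳ-≡ (2 * G) _ _ (begin
      2 * L + 2 * G
        ≡⟨ step₁ L G ⟩
      2 * (G + L)
        ≡⟨ cong (2 *_) total ⟩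
      2 * (N * suc t + (g * (t * t) + F))
        ≡⟨ step₂ F (N * suc t) (g * (t * t)) ⟩
      2 * (g * (t * t)) + (2 * (N * suc t) + 2 * F)
        ≡⟨ cong (λ e → 2 * (g * (t * t)) + e) (sum<-/8-⌈/8⌉ t) ⟩
      2 * (g * (t * t)) + (t * suc t + 2 + 2 * G)
        ≡⟨ step₃ G (t * suc t) (g * (t * t)) ⟩
      2 * (g * (t * t)) + 1 * (t * suc t) + 2 + 2 * G ∎)
      where
      open ≡-Reasoning
      L = sum< N rowLength
      G = sum< N rowStart
      F = sum< N (_/ 8)
      step₁ : ∀ L G → 2 * L + 2 * G ≡ 2 * (G + L)
      step₁ = solve-∀
      step₂ : ∀ F a b → 2 * (a + (b + F)) ≡ 2 * b + (2 * a + 2 * F)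
      step₂ = solve-∀
      step₃ : ∀ G a b → 2 * b + (a + 2 + 2 * G) ≡ 2 * b + 1 * a + 2 + 2 * G
      step₃ = solve-∀
      total : G + L ≡ N * suc t + (g * (t * t) + F)
      total = begin
        G + L
          ≡⟨ sum<-+ N rowStart rowLength ⟨
        sum< N (λ n → rowStart n + rowLength n)
          -- The extension by g times the tent is an integer and leaves the floor, so rounding
          -- affects only the base triangle.
          ≡⟨ sum<-cong N (λ n n<N → trans (rowStart+rowLength n n<N)
               (cong suc (trans ([k*d+m]/d (t + g * tent n) n 8) (+-assoc t (g * tent n) (n / 8))))) ⟩
        sum< N (λ n → suc t + (g * tent n + n / 8))
          ≡⟨ sum<-+ N (λ _ → suc t) (λ n → g * tent n + n / 8) ⟩
        sum< N (λ _ → suc t) + sum< N (λ n → g * tent n + n / 8)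
          ≡⟨ cong₂ _+_ (sum<-const N (suc t)) (trans (sum<-+ N (λ n → g * tent n) (_/ 8))
               (cong (_+ F) (trans (sum<-* g N tent) (cong (g *_) (sum<-tent t))))) ⟩
        N * suc t + (g * (t * t) + F) ∎

  private
    natural : ∀ t z → Satisfies sides t z → ∃[ m ] ∃[ n ] z ≡ (+ m , + n)
    natural t (x , y) h with n , refl ← 0≤∙y⇒nonNegative x y (+ t) (h 0F)
                        with m , refl ← ≤∙x⇒nonNegative 7 3 4 x n t (h 3F) = m , n , refl

    module _ {t m n : ℕ} (h : Satisfies sides t (+ m , + n)) where
      lower : 8 * m ≤ (1 + 8 * g) * n + 8 * t
      lower = ≤-certificate 0 (Satisfies⇒ℕ sides h 1F) (identity g m n t)
        where
        identity : ∀ g m n t → 8 * m + (0 * m + (1 + 8 * g) * n + 8 * t) + 0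
          ≡ (1 + 8 * g) * n + 8 * t + (8 * m + 0 * n + 0 * t)
        identity = solve-∀
      upper : 8 * m + 8 * g * n ≤ n + (8 + 16 * g) * t
      upper = ≤-certificate 0 (Satisfies⇒ℕ sides h 2F) (identity g m n t)
        where
        identity : ∀ g m n t → 8 * m + 8 * g * n + (0 * m + 1 * n + (8 + 16 * g) * t) + 0
          ≡ n + (8 + 16 * g) * t + (8 * m + 8 * g * n + 0 * t)
        identity = solve-∀
      left : 4 * t + 3 * n ≤ m * 8
      left = ≤-certificate 0 (Satisfies⇒ℕ sides h 3F) (identity m n t)
        where
        identity : ∀ m n t → 4 * t + 3 * n + (8 * m + 0 * n + 0 * t) + 0 ≡ m * 8 + (0 * m + 3 * n + 4 * t)
        identity = solve-∀
      height : n ≤ 2 * t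
      height = *-cancelˡ-≤ (2 + 8 * g) (≤-certificate 0 (+-mono-≤ upper left) (identity g m n t))
        where
        identity : ∀ g m n t → (2 + 8 * g) * n + (n + (8 + 16 * g) * t + m * 8) + 0
          ≡ (2 + 8 * g) * (2 * t) + (8 * m + 8 * g * n + (4 * t + 3 * n))
        identity = solve-∀

    satisfies : ∀ {t m n} → 8 * m ≤ (1 + 8 * g) * n + 8 * t → 8 * m + 8 * g * n ≤ n + (8 + 16 * g) * t →
      4 * t + 3 * n ≤ m * 8 → Satisfies sides t (+ m , + n)
    satisfies {t} {m} {n} lower upper left = ℕ⇒Satisfies sides λ
      { 0F → z≤n
      ; 1F → ≤-certificate 0 lower (identity₁ g m n t)
      ; 2F → ≤-certificate 0 upper (identity₂ g m n t)
      ; 3F → ≤-certificate 0 left (identity₃ m n t) }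
      where
      identity₁ : ∀ g m n t → 8 * m + 0 * n + 0 * t + ((1 + 8 * g) * n + 8 * t) + 0
        ≡ 0 * m + (1 + 8 * g) * n + 8 * t + 8 * m
      identity₁ = solve-∀
      identity₂ : ∀ g m n t → 8 * m + 8 * g * n + 0 * t + (n + (8 + 16 * g) * t) + 0
        ≡ 0 * m + 1 * n + (8 + 16 * g) * t + (8 * m + 8 * g * n)
      identity₂ = solve-∀
      identity₃ : ∀ m n t → 0 * m + 3 * n + 4 * t + m * 8 + 0 ≡ 8 * m + 0 * n + 0 * t + (4 * t + 3 * n)
      identity₃ = solve-∀

  count : ∀ t → ∃[ c ] HasCard (Satisfies sides t) c × 2 * c ≡ 2 * (g * (t * t)) + 1 * (t * suc t) + 2
  count t = _ , rows-HasCard (rowStart t) (rowLength t) (suc (2 * t)) _ to from , sum<-rowLength t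
    where
    to : ∀ z → Satisfies sides t z → ∃[ m ] ∃[ n ] z ≡ (+ m , + n) × n < suc (2 * t) ×
      rowStart t n ≤ m × m < rowStart t n + rowLength t n
    to z h with m , n , refl ← natural t z h = m , n , refl , n<N ,
      n≤m*d⇒n⌈/⌉d≤m (4 * t + 3 * n) m 8 (left h) ,
      subst (m <_) (sym (rowStart+rowLength t n n<N)) (s≤s (≤rowEnd t m n n<N (lower h) (upper h)))
      where n<N = s≤s (height h)
    from : ∀ m n → n < suc (2 * t) → rowStart t n ≤ m → m < rowStart t n + rowLength t n → Satisfies sides t (+ m , + n)
    from m n n<N s≤m m<e =
      let lower , upper = ≤rowEnd⁻¹ t m n n<N (s≤s⁻¹ (subst (m <_) (rowStart+rowLength t n n<N) m<e))
      in satisfies lower upper (n⌈/⌉d≤m⇒n≤m*d (4 * t + 3 * n) m 8 s≤m)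

  private
    row≤2 : ∀ n → n ≤ 2 * 1 → n ≡ 0 ⊎ n ≡ 1 ⊎ n ≡ 2
    row≤2 0 _ = inj₁ refl
    row≤2 1 _ = inj₂ (inj₁ refl)
    row≤2 2 _ = inj₂ (inj₂ refl)
    row≤2 (suc (suc (suc n))) (s≤s (s≤s ()))

    1≤ : ∀ n {m} → suc n ≤ m * 8 → 1 ≤ m
    1≤ n {suc m} _ = s≤s z≤n

    -- At height 2 the polygon consists of the vertex (5/4, 2) alone. The absurd numerical
    -- inequalities are refuted by evaluating `_≤ᵇ_`.
    no-row-2 : ∀ {m} → ¬ Satisfies sides 1 (+ m , + 2)
    no-row-2 {0} h = ≤⇒≤ᵇ (left h)
    no-row-2 {1} h = ≤⇒≤ᵇ (left h)
    no-row-2 {suc (suc m)} h = ≤⇒≤ᵇ (≤-certificate {a = 16} {b = 10} (8 * m) (upper h) (identity g m))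
      where
      identity : ∀ g m → 16 + (2 + (8 + 16 * g) * 1) + 8 * m ≡ 10 + (8 * suc (suc m) + 8 * g * 2)
      identity = solve-∀

    row-1-bound : ∀ {m} → Satisfies sides 1 (+ m , + 1) → m < 2 + g
    row-1-bound {m} h = *-cancelˡ-< 8 m (2 + g) (≤-certificate 6 (lower h) (identity g m))
      where
      identity : ∀ g m → suc (8 * m) + ((1 + 8 * g) * 1 + 8 * 1) + 6 ≡ 8 * (2 + g) + 8 * m
      identity = solve-∀

    -- Row 1 spans 7/8 ≤ x ≤ g + 9/8 with neither end integral, so all its g + 1 lattice points are
    -- interior.
    strict-row1 : ∀ {m} → 1 ≤ m → m < 2 + g → StrictlySatisfies sides 1 (+ m , + 1)
    strict-row1 {m} 1≤m m<2+g = ℕ⇒StrictlySatisfies sides λ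
      { 0F → s≤s z≤n
      ; 1F → ≤-certificate 0 (*-monoʳ-≤ 8 m<2+g) (identity₁ g m)
      ; 2F → ≤-certificate 0 (*-monoʳ-≤ 8 m<2+g) (identity₂ g m)
      ; 3F → ≤-certificate 0 (*-monoʳ-≤ 8 1≤m) (identity₃ m) }
      where
      identity₁ : ∀ g m → suc (8 * m + 0 * 1 + 0 * 1) + 8 * (2 + g) + 0 ≡ 0 * m + (1 + 8 * g) * 1 + 8 * 1 + 8 * suc m
      identity₁ = solve-∀
      identity₂ : ∀ g m → suc (8 * m + 8 * g * 1 + 0 * 1) + 8 * (2 + g) + 0 ≡ 0 * m + 1 * 1 + (8 + 16 * g) * 1 + 8 * suc m
      identity₂ = solve-∀
      identity₃ : ∀ m → suc (0 * m + 3 * 1 + 4 * 1) + 8 * m + 0 ≡ 8 * m + 0 * 1 + 0 * 1 + 8 * 1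
      identity₃ = solve-∀

  interior : HasCard (StrictlySatisfies sides 1) (suc g)
  interior = rows-HasCard (λ _ → 1) len 2 _ to from
    where
    len : ℕ → ℕ
    len 0       = 0
    len (suc _) = suc g
    place : ∀ m n → StrictlySatisfies sides 1 (+ m , + n) → n ≡ 0 ⊎ n ≡ 1 ⊎ n ≡ 2 → n < 2 × 1 ≤ m × m < 1 + len n
    place m .0 h (inj₁ refl) = contradiction (StrictlySatisfies⇒ℕ sides h 0F) λ ()
    place m .1 h (inj₂ (inj₁ refl)) = s≤s (s≤s z≤n) ,
      1≤ 6 (left (StrictlySatisfies⇒Satisfies sides h)) , row-1-bound (StrictlySatisfies⇒Satisfies sides h)
    place m .2 h (inj₂ (inj₂ refl)) = contradiction (StrictlySatisfies⇒Satisfies sides h) no-row-2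
    to : ∀ z → StrictlySatisfies sides 1 z → ∃[ m ] ∃[ n ] z ≡ (+ m , + n) × n < 2 × 1 ≤ m × m < 1 + len n
    to z h with m , n , refl ← natural 1 z (StrictlySatisfies⇒Satisfies sides h) =
      m , n , refl , place m n h (row≤2 n (height (StrictlySatisfies⇒Satisfies sides h)))
    from : ∀ m n → n < 2 → 1 ≤ m → m < 1 + len n → StrictlySatisfies sides 1 (+ m , + n)
    from m 0 _ 1≤m m<1 = contradiction m<1 (≤⇒≯ 1≤m)
    from m 1 _ 1≤m m<  = strict-row1 1≤m m<
    from m (suc (suc n)) (s≤s (s≤s ()))

  -- Only the bottom edge from 1/2 to 1 meets the lattice, in (1, 0).
  boundary : HasCard (λ z → Satisfies sides 1 z × ¬ StrictlySatisfies sides 1 z) 1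
  boundary = rows-HasCard (λ _ → 1) (λ _ → 1) 1 _ to from
    where
    place : ∀ m n → Satisfies sides 1 (+ m , + n) → ¬ StrictlySatisfies sides 1 (+ m , + n) →
      n ≡ 0 ⊎ n ≡ 1 ⊎ n ≡ 2 → n < 1 × 1 ≤ m × m < 2
    place m .0 h ¬strict (inj₁ refl) = s≤s z≤n , 1≤ 3 (left h) , *-cancelˡ-< 8 m 2 (≤-certificate 7 (lower h) (identity g m))
      where
      identity : ∀ g m → suc (8 * m) + ((1 + 8 * g) * 0 + 8 * 1) + 7 ≡ 8 * 2 + 8 * m
      identity = solve-∀
    place m .1 h ¬strict (inj₂ (inj₁ refl)) = contradiction (strict-row1 (1≤ 6 (left h)) (row-1-bound h)) ¬strict
    place m .2 h ¬strict (inj₂ (inj₂ refl)) = contradiction h no-row-2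
    to : ∀ z → Satisfies sides 1 z × ¬ StrictlySatisfies sides 1 z →
      ∃[ m ] ∃[ n ] z ≡ (+ m , + n) × n < 1 × 1 ≤ m × m < 2
    to z (h , ¬strict) with m , n , refl ← natural 1 z h = m , n , refl , place m n h ¬strict (row≤2 n (height h))
    from : ∀ m n → n < 1 → 1 ≤ m → m < 2 → Satisfies sides 1 (+ m , + n) × ¬ StrictlySatisfies sides 1 (+ m , + n)
    from 1 0 _ _ _ =
      satisfies (≤-slack 0 (identity₁ g)) (≤-slack (16 * g) (identity₂ g)) (≤-slack 4 refl) ,
      λ h → contradiction (StrictlySatisfies⇒ℕ sides h 0F) λ ()
      where
      identity₁ : ∀ g → 8 * 1 + 0 ≡ (1 + 8 * g) * 0 + 8 * 1
      identity₁ = solve-∀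
      identity₂ : ∀ g → 8 * 1 + 8 * g * 0 + 16 * g ≡ 0 + (8 + 16 * g) * 1
      identity₂ = solve-∀
    from 0 _ _ ()
    from (suc (suc m)) _ _ _ (s≤s (s≤s ()))
    from 1 (suc n) (s≤s ())

theorem1p7 : (i b : ℕ) → 1 ≤ i → 1 ≤ b → b ≤ 5 * i + 4 →
    Σ Polygon λ P → Pseudointegral P × HasCard (λ z → InInterior P (embed z)) i × HasCard (λ z → OnBoundary P (embed z)) b
theorem1p7 (suc g) 1 _ _ _ = pseudointegral-polygon sides g (suc g) 1 (narrow g) count interior boundary
  where
  open Narrow g using (sides)
  open NarrowCount g
theorem1p7 (suc g) (suc (suc e)) _ _ b≤5i+4 =
  pseudointegral-polygon sides g (suc g) (2 + e) (wide g e δ δ+c) count interior boundary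
  where
  -- This is 5i + 4 - b for i = g + 1 and b = e + 2; the bound on b says that nothing is truncated.
  δ = 8 + 5 * g ∸ suc e
  δ+c : δ + suc e ≡ 8 + 5 * g
  δ+c = m∸n+n≡m {8 + 5 * g} {suc e} (≤-certificate 0 b≤5i+4 (identity g e))
    where
    identity : ∀ g e → suc e + (5 * suc g + 4) + 0 ≡ 8 + 5 * g + suc (suc e)
    identity = solve-∀
  open Wide g e δ δ+c using (sides)
  open WideCount g e δ δ+c
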